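{- Let $p$ be an odd prime, $n\ge 1$, $r,t\ge 0$ integers, and $c\neq 0$ an element of $\mathbb{F}_p$. Then: (i) the function $f:\mathbb{F}_{p^n}\to\mathbb{F}_p$, $f(x)=\mathrm{Tr}_n(cx^{p^r+1}-cx^{p^t+1})$, is near-bent if and only if $\gcd(n,r+t)=\gcd(n,r-t)=\gcd(n,p)=1$; (ii) the function $f:\mathbb{F}_{p^n}\to\mathbb{F}_p$, $f(x)=\mathrm{Tr}_n(cx^{p^r+1}+cx^{p^t+1})$, is near-bent if and only if $\gcd(n,2(r+t))=\gcd(n,2(r-t))=2$, $r-t$ is odd, and $\gcd(n,p)=1$.
   Context: $\mathrm{Tr}_n$ is the absolute trace $\mathbb{F}_{p^n}\to\mathbb{F}_p$, $\epsilon_p=e^{2\pi i/p}$, $\widehat{f}(b)=\sum_{x\in\mathbb{F}_{p^n}}\epsilon_p^{f(x)-\mathrm{Tr}_n(bx)}$. A function $f:\mathbb{F}_{p^n}\to\mathbb{F}_p$ is near-bent if $|\widehat f(b)|^2\in\{0,p^{n+1}\}$ for all $b\in\mathbb{F}_{p^n}$. -}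

module Defs where

open import Data.Nat as ℕ using (ℕ; zero; suc; NonZero)
open import Data.Nat.DivMod using (_mod_)
open import Data.Fin as Fin using (Fin; toℕ)
import Data.Fin.Properties as FinP
open import Data.Integer as ℤ using (ℤ; +_)
open import Data.List using (List; []; _∷_; map; allFin; foldr)
open import Data.Maybe using (Maybe; just; nothing; fromMaybe)
open import Data.Product using (∃)
open import Data.Sum using (_⊎_)
open import Relation.Nullary using (¬_; yes; no)
open import Relation.Binary.PropositionalEquality using (_≡_)
open import Relation.Binary.Definitions using (DecidableEquality)
open import Algebra.Structures using (IsCommutativeRing)
open import Function.Bundles using (_↔_; Inverse)

record FiniteField (p n : ℕ) : Set₁ where
  infixl 6 _+_ _-_
  infixl 7 _*_
  field
    Carrier : Set
    _+_ _*_ : Carrier → Carrier → Carrier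
    -_      : Carrier → Carrier
    0# 1#   : Carrier
    isCommutativeRing : IsCommutativeRing _≡_ _+_ _*_ -_ 0# 1#
    0≢1     : ¬ (0# ≡ 1#)
    inverse : ∀ x → ¬ (x ≡ 0#) → ∃ λ y → x * y ≡ 1#
    _≟_     : DecidableEquality Carrier
    enum    : Fin (ℕ._^_ p n) ↔ Carrier

  _-_ : Carrier → Carrier → Carrier
  x - y = x + (- y)

  pow : Carrier → ℕ → Carrier
  pow x zero    = 1#
  pow x (suc k) = x * pow x k

  ι : ℕ → Carrier
  ι zero    = 0#
  ι (suc k) = 1# + ι k

  sumF : List Carrier → Carrier
  sumF = foldr _+_ 0#

  trElt : Carrier → Carrier
  trElt x = sumF (map (λ i → pow x (ℕ._^_ p (toℕ i))) (allFin n))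

  private
    search : Carrier → List (Fin p) → Maybe (Fin p)
    search y [] = nothing
    search y (k ∷ ks) with ι (toℕ k) ≟ y
    ... | yes _ = just k
    ... | no  _ = search y ks

  zeroFin : .{{_ : NonZero p}} → Fin p
  zeroFin = 0 mod p

  Tr : .{{_ : NonZero p}} → Carrier → Fin p
  Tr x = fromMaybe zeroFin (search (trElt x) (allFin p))

  embedFp : Fin p → Carrier
  embedFp c = ι (toℕ c)

  sumAll : {A : Set} → (A → A → A) → A → (Carrier → A) → A
  sumAll _⊕_ e g = foldr _⊕_ e (map (λ i → g (Inverse.to enum i)) (allFin (ℕ._^_ p n)))

module _ (p : ℕ) .{{_ : NonZero p}} where
  addFp : Fin p → Fin p → Fin p
  addFp i j = (toℕ i ℕ.+ toℕ j) mod p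

  negFp : Fin p → Fin p
  negFp i = (p ℕ.∸ toℕ i) mod p

  subFp : Fin p → Fin p → Fin p
  subFp i j = addFp i (negFp j)

-- The cyclotomic ring Z[ε_p] = Z[x]/(1 + x + ... + x^{p-1}), which embeds
-- into ℂ via x ↦ ε_p = e^{2πi/p}.  An element Σ_k a_k ε_p^k is represented
-- by its coefficient function a : Fin p → ℤ; two representations are equal
-- iff their difference is a constant multiple of 1 + ε_p + ... + ε_p^{p-1}.

Cyc : ℕ → Set
Cyc p = Fin p → ℤ

sumℤ : List ℤ → ℤ
sumℤ = foldr ℤ._+_ (+ 0)

module _ (p : ℕ) .{{_ : NonZero p}} where
  _≈ᶜ_ : Cyc p → Cyc p → Set
  a ≈ᶜ b = ∃ λ (c : ℤ) → ∀ k → a k ℤ.- b k ≡ c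

  zeroᶜ : Cyc p
  zeroᶜ _ = + 0

  _+ᶜ_ : Cyc p → Cyc p → Cyc p
  (a +ᶜ b) k = a k ℤ.+ b k

  εpow : Fin p → Cyc p
  εpow k j with j Fin.≟ k
  ... | yes _ = + 1
  ... | no  _ = + 0

  intᶜ : ℤ → Cyc p
  intᶜ m j with j Fin.≟ (0 mod p)
  ... | yes _ = m
  ... | no  _ = + 0

  _*ᶜ_ : Cyc p → Cyc p → Cyc p
  (a *ᶜ b) k = sumℤ (map (λ i → a i ℤ.* b (subFp p k i)) (allFin p))

  -- complex conjugation: ε_p^k ↦ ε_p^{-k}
  conjᶜ : Cyc p → Cyc p
  conjᶜ a k = a (negFp p k)

  normSqᶜ : Cyc p → Cyc p
  normSqᶜ z = z *ᶜ conjᶜ z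

module _ {p n : ℕ} (F : FiniteField p n) .{{_ : NonZero p}} where
  open FiniteField F

  walsh : (Carrier → Fin p) → Carrier → Cyc p
  walsh f b = sumAll (_+ᶜ_ p) (zeroᶜ p) (λ x → εpow p (subFp p (f x) (Tr (b * x))))

  NearBent : (Carrier → Fin p) → Set
  NearBent f = ∀ b → _≈ᶜ_ p (normSqᶜ p (walsh f b)) (intᶜ p (+ 0))
                   ⊎ _≈ᶜ_ p (normSqᶜ p (walsh f b)) (intᶜ p (+ (ℕ._^_ p (suc n))))

{-# OPTIONS --safe #-}
-- Write σ for the Frobenius map, τ for the trace and Q for the argument of the
-- trace in f.  The polar form of τ ∘ Q is τ (L u * y) with L F_p-linear, so the
-- coefficients of |f^(b)|² are those of p^n Σ_{u ∈ ker L} ε^{-Tr (b u)} up to a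
-- common constant (f vanishes on ker L because p is odd).  That sum is 0 or
-- |ker L|, hence f is near-bent iff |ker L| = p.  Up to a unit,
-- L = (σ^(r+t) ∓ 1)(σ^(r-t) ∓ 1).  For the minus sign the kernel contains F_p,
-- and it is no larger exactly under the gcd conditions: a common divisor of n
-- and r ± t gives a bigger fixed field, and p ∣ n gives a solution of
-- σ x = x + e with e ≠ 0 (additive Hilbert 90).  For the plus sign the kernel
-- is trivial for odd n; for even n there is z ≠ 0 with σ z = - z,
-- multiplication by z preserves the kernel if r ± t are even, and carries the
-- kernel for the minus sign onto it if they are odd.
module Submission where

open import Defs
open import Algebra.Bundles using (CommutativeMonoid; CommutativeRing)
open import Data.Fin as Fin using (Fin; toℕ; fromℕ)
import Data.Fin.Properties as FinP
open import Data.Integer as ℤ using (ℤ)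
import Data.Integer.Properties as ℤₚ
open import Data.Integer.Solver using (module +-*-Solver)
open import Data.List using (List; []; _∷_; map; allFin; foldr; tabulate; length)
import Data.List.Properties as List
open import Data.List.Membership.Propositional using (_∈_)
open import Data.List.Membership.Propositional.Properties using (∈-allFin)
open import Data.List.Relation.Unary.All as All using (All; []; _∷_)
import Data.List.Relation.Unary.All.Properties as All
open import Data.List.Relation.Unary.AllPairs using ([]; _∷_)
open import Data.List.Relation.Unary.Any using (here; there)
open import Data.List.Relation.Unary.Unique.Propositional using (Unique)
import Data.List.Relation.Unary.Unique.Propositional.Properties as Unique
open import Data.Maybe using (Maybe; just; nothing)
open import Data.Nat as ℕ using (ℕ; zero; suc; NonZero; _^_; _!; _≤_; ∣_-_∣; _%_; s≤s; z≤n)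
open import Data.Nat.Combinatorics using (_C_; nCk≡n!/k![n-k]!; nCn≡1; k![n∸k]!∣n!)
open import Data.Nat.Coprimality using (Coprime; coprime-Bézout; gcd≡1⇒coprime)
open import Data.Nat.Divisibility using (_∣_; divides; _∣?_; ∣⇒≤; ∣-trans; ∣1⇒≡1; m∣m*n; n∣m*n)
open import Data.Nat.DivMod using (_mod_; _/_; m≡m%n+[m/n]*n; m*[n/m]≡n; m%n<n; [m+kn]%n≡m%n)
open import Data.Nat.GCD using (gcd; gcd[m,n]∣m; gcd[m,n]∣n; gcd-greatest; c*gcd[m,n]≡gcd[cm,cn]; gcd[m,n]≡0⇒m≡0; module Bézout)
open import Data.Nat.Primality using (Prime; euclidsLemma; prime⇒nonTrivial; prime⇒irreducible)
import Data.Nat.Properties as ℕₚ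
open import Data.Product using (∃; _×_; _,_; proj₁; proj₂)
open import Data.Sum using (_⊎_; inj₁; inj₂; [_,_]′)
open import Function using (_∘_; id)
open import Function.Bundles using (_↔_; Inverse; mk↔ₛ′; _⇔_; mk⇔; Equivalence)
open import Function.Construct.Identity using (↔-id)
open import Function.Properties.Equivalence using () renaming (trans to ⇔-trans)
open import Level using (0ℓ)
open import Relation.Binary.PropositionalEquality using (_≡_; _≢_; refl; cong; cong₂; sym; trans; subst; module ≡-Reasoning)
open import Relation.Nullary using (¬_; Dec; yes; no; contradiction)
open import Relation.Nullary.Decidable using (¬?; decidable-stable; _×-dec_)
open import Relation.Unary using (Decidable)
-- Finite sums

-- Complex numbers never appear: an element of Z[ε_p] is a coefficient vector modulo constant
-- vectors, so the vanishing of a character sum becomes the statement that a function takes each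
-- value in F_p equally often, and this is shown by a translation (`equidistributed`). `FiniteField`
-- prescribes only the number of elements; the characteristic and `x ^ (p ^ n) = x` have to be
-- derived from it by reindexing sums and products over the field. Elements with special properties
-- are obtained by degree: a monic polynomial function of degree below `p ^ n` has a non-root.
-- Kernel sizes are not computed through dimensions. A set that contains the line F_p w has p
-- elements exactly if it is that line, so |ker L| = p turns into an inclusion. Exponents of σ are
-- natural numbers. Hence σ^(-r) is represented by σ^((n-1)r), and L is composed with the injective
-- map σ^r before it is factored. Exchanging r and t multiplies L only by the sign, which is why the
-- distance of r and t can replace r - t.

module Summation {N : ℕ} {X : Set} (enum : Fin N ↔ X) (M : CommutativeMonoid 0ℓ 0ℓ) where
  open CommutativeMonoid M renaming (Carrier to A; refl to ≈-refl; sym to ≈-sym; trans to ≈-trans)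
  open import Algebra.Properties.CommutativeMonoid.Sum M
  open Inverse enum using (to; from; strictlyInverseˡ; strictlyInverseʳ)

  -- `M` is left general because the same sums are taken in ℤ, in the additive group of the field
  -- and, as products, in its multiplicative monoid.
  ∑ : (X → A) → A
  ∑ g = sum (g ∘ to)

  ∑-cong : ∀ {g h} → (∀ x → g x ≈ h x) → ∑ g ≈ ∑ h
  ∑-cong eq = sum-cong-≋ (λ i → eq (to i))

  ∑-reindex : ∀ g (h h⁻¹ : X → X) → (∀ x → h (h⁻¹ x) ≡ x) → (∀ x → h⁻¹ (h x) ≡ x) → ∑ g ≈ ∑ (g ∘ h)
  ∑-reindex g h h⁻¹ hh⁻¹ h⁻¹h = ≈-trans (sum-permute (g ∘ to) π)
    (sum-cong-≋ λ i → reflexive (cong g (strictlyInverseˡ (h (to i)))))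
    where
    π : Fin N ↔ Fin N
    π = mk↔ₛ′ (from ∘ h ∘ to) (from ∘ h⁻¹ ∘ to)
      (λ i → trans (cong (from ∘ h) (strictlyInverseˡ _)) (trans (cong from (hh⁻¹ _)) (strictlyInverseʳ i)))
      (λ i → trans (cong (from ∘ h⁻¹) (strictlyInverseˡ _)) (trans (cong from (h⁻¹h _)) (strictlyInverseʳ i)))

  ∑-distrib : ∀ g h → ∑ (λ x → g x ∙ h x) ≈ ∑ g ∙ ∑ h
  ∑-distrib g h = ∑-distrib-+ (g ∘ to) (h ∘ to)

  sum-point : ∀ {m} (t : Fin m → A) i → (∀ j → j ≢ i → t j ≈ ε) → sum t ≈ t i
  sum-point {suc m} t i t≈ε = ≈-trans (sum-remove t)
    (≈-trans (∙-congˡ (≈-trans (sum-cong-≋ (λ j → t≈ε _ (FinP.punchInᵢ≢i i j))) (sum-replicate-zero m)))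
             (identityʳ _))

  ∑-point : ∀ x₀ g → (∀ x → x ≢ x₀ → g x ≈ ε) → ∑ g ≈ g x₀
  ∑-point x₀ g g≈ε = ≈-trans
    (sum-point (g ∘ to) (from x₀) (λ j j≢ → g≈ε _ λ eq → j≢ (trans (sym (strictlyInverseʳ j)) (cong from eq))))
    (reflexive (cong g (strictlyInverseˡ x₀)))

  foldr-tabulate : ∀ {m} (t : Fin m → A) → foldr _∙_ ε (tabulate t) ≡ sum t
  foldr-tabulate {zero}  t = refl
  foldr-tabulate {suc m} t = cong (t Fin.zero ∙_) (foldr-tabulate (t ∘ Fin.suc))

  -- `sumAll` and `sumℤ` are folds over lists; this turns them into `sum`, for which permutation and
  -- exchange of summations are available.
  foldr-allFin : ∀ g → foldr _∙_ ε (map (g ∘ to) (allFin N)) ≡ ∑ g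
  foldr-allFin g = trans (cong (foldr _∙_ ε) (List.map-tabulate id (g ∘ to))) (foldr-tabulate (g ∘ to))

module _ {N₁ N₂ : ℕ} {X₁ X₂ : Set} (e₁ : Fin N₁ ↔ X₁) (e₂ : Fin N₂ ↔ X₂) (M : CommutativeMonoid 0ℓ 0ℓ) where
  open CommutativeMonoid M using (_≈_) renaming (Carrier to A)
  open import Algebra.Properties.CommutativeMonoid.Sum M using (∑-comm)
  private
    module S₁ = Summation e₁ M
    module S₂ = Summation e₂ M

  ∑-swap : ∀ (f : X₁ → X₂ → A) → S₁.∑ (λ x → S₂.∑ (f x)) ≈ S₂.∑ (λ y → S₁.∑ (λ x → f x y))
  ∑-swap f = ∑-comm (λ i j → f (Inverse.to e₁ i) (Inverse.to e₂ j))

-- The ring solver with integer coefficients: over the ring itself, whose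
-- equality test does not compute, cancellations would not be found.
module IntegerCoefficients (R : CommutativeRing 0ℓ 0ℓ) where
  open import Data.Integer using (+_; -[1+_])
  open CommutativeRing R renaming (refl to ≈-refl; sym to ≈-sym; trans to ≈-trans)
  open import Algebra.Properties.Ring ring
  open import Algebra.Properties.AbelianGroup +-abelianGroup using (⁻¹-∙-comm)
  -- With this multiple `1 ×ᴿ 1#` reduces to `1#`, so `con (+ 1)` denotes `1#` definitionally and
  -- `solve` meets the terms as they are written.
  open import Algebra.Properties.Semiring.Mult.TCOptimised semiring renaming (_×_ to _×ᴿ_)
  open import Algebra.Solver.Ring.AlmostCommutativeRing
  open import Relation.Binary.Reasoning.Setoid setoid
  import Algebra.Solver.Ring as Solver

  ⟦_⟧ℤ : ℤ → Carrier
  ⟦ + n ⟧ℤ      = n ×ᴿ 1#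
  ⟦ -[1+ n ] ⟧ℤ = - (suc n ×ᴿ 1#)

  neg-homo : ∀ i → ⟦ ℤ.- i ⟧ℤ ≈ - ⟦ i ⟧ℤ
  neg-homo (+ zero)   = ≈-sym -0#≈0#
  neg-homo (+ suc n)  = ≈-refl
  neg-homo -[1+ n ]   = ≈-sym (-‿involutive _)

  cancel-suc : ∀ a b → (1# + a) - (1# + b) ≈ a - b
  cancel-suc a b = begin
    (1# + a) + - (1# + b)     ≈⟨ +-cong (+-comm 1# a) (≈-sym (⁻¹-∙-comm 1# b)) ⟩
    (a + 1#) + (- 1# + - b)   ≈⟨ +-assoc a 1# _ ⟩
    a + (1# + (- 1# + - b))   ≈⟨ +-congˡ (≈-sym (+-assoc 1# (- 1#) (- b))) ⟩
    a + ((1# - 1#) - b)       ≈⟨ +-congˡ (+-congʳ (-‿inverseʳ 1#)) ⟩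
    a + (0# - b)              ≈⟨ +-congˡ (+-identityˡ _) ⟩
    a - b                     ∎

  ⊖-homo : ∀ m n → ⟦ m ℤ.⊖ n ⟧ℤ ≈ m ×ᴿ 1# - n ×ᴿ 1#
  ⊖-homo zero    zero    = ≈-sym (-‿inverseʳ 0#)
  ⊖-homo (suc m) zero    = ≈-sym (≈-trans (+-congˡ -0#≈0#) (+-identityʳ _))
  ⊖-homo zero    (suc n) = ≈-sym (+-identityˡ _)
  ⊖-homo (suc m) (suc n) = begin
    ⟦ suc m ℤ.⊖ suc n ⟧ℤ          ≡⟨ cong ⟦_⟧ℤ (ℤₚ.[1+m]⊖[1+n]≡m⊖n m n) ⟩
    ⟦ m ℤ.⊖ n ⟧ℤ                  ≈⟨ ⊖-homo m n ⟩
    m ×ᴿ 1# - n ×ᴿ 1#               ≈⟨ cancel-suc _ _ ⟨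
    (1# + m ×ᴿ 1#) - (1# + n ×ᴿ 1#) ≈⟨ +-cong (≈-sym (1+× m 1#)) (-‿cong (≈-sym (1+× n 1#))) ⟩
    suc m ×ᴿ 1# - suc n ×ᴿ 1#       ∎

  +-homo : ∀ i j → ⟦ i ℤ.+ j ⟧ℤ ≈ ⟦ i ⟧ℤ + ⟦ j ⟧ℤ
  +-homo (+ m)    (+ n)    = ×-homo-+ 1# m n
  +-homo (+ m)    -[1+ n ] = ⊖-homo m (suc n)
  +-homo -[1+ m ] (+ n)    = ≈-trans (⊖-homo n (suc m)) (+-comm _ _)
  +-homo -[1+ m ] -[1+ n ] = begin
    - (suc (suc (m ℕ.+ n)) ×ᴿ 1#)          ≈⟨ -‿cong (1+× (suc (m ℕ.+ n)) 1#) ⟩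
    - (1# + suc (m ℕ.+ n) ×ᴿ 1#)           ≈⟨ -‿cong (+-congˡ (×-homo-+ 1# (suc m) n)) ⟩
    - (1# + (suc m ×ᴿ 1# + n ×ᴿ 1#))        ≈⟨ -‿cong (≈-trans (≈-sym (+-assoc _ _ _)) (≈-trans (+-congʳ (+-comm _ _)) (+-assoc _ _ _))) ⟩
    - (suc m ×ᴿ 1# + (1# + n ×ᴿ 1#))        ≈⟨ -‿cong (+-congˡ (1+× n 1#)) ⟨
    - (suc m ×ᴿ 1# + suc n ×ᴿ 1#)           ≈⟨ ⁻¹-∙-comm _ _ ⟨
    - (suc m ×ᴿ 1#) + - (suc n ×ᴿ 1#)       ∎

  pos-homo : ∀ m n → ⟦ + m ℤ.* + n ⟧ℤ ≈ ⟦ + m ⟧ℤ * ⟦ + n ⟧ℤ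
  pos-homo m n = ≈-trans (reflexive (cong ⟦_⟧ℤ (sym (ℤₚ.pos-* m n)))) (×1-homo-* m n)

  *-homo : ∀ i j → ⟦ i ℤ.* j ⟧ℤ ≈ ⟦ i ⟧ℤ * ⟦ j ⟧ℤ
  *-homo (+ m)    (+ n)    = pos-homo m n
  *-homo (+ m)    -[1+ n ] = begin
    ⟦ + m ℤ.* -[1+ n ] ⟧ℤ            ≡⟨ cong ⟦_⟧ℤ (sym (ℤₚ.neg-distribʳ-* (+ m) (+ suc n))) ⟩
    ⟦ ℤ.- (+ m ℤ.* + suc n) ⟧ℤ       ≈⟨ neg-homo (+ m ℤ.* + suc n) ⟩
    - ⟦ + m ℤ.* + suc n ⟧ℤ           ≈⟨ -‿cong (pos-homo m (suc n)) ⟩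
    - (⟦ + m ⟧ℤ * ⟦ + suc n ⟧ℤ)      ≈⟨ -‿distribʳ-* _ _ ⟩
    ⟦ + m ⟧ℤ * ⟦ -[1+ n ] ⟧ℤ         ∎
  *-homo -[1+ m ] (+ n)    = begin
    ⟦ -[1+ m ] ℤ.* + n ⟧ℤ            ≡⟨ cong ⟦_⟧ℤ (sym (ℤₚ.neg-distribˡ-* (+ suc m) (+ n))) ⟩
    ⟦ ℤ.- (+ suc m ℤ.* + n) ⟧ℤ       ≈⟨ neg-homo (+ suc m ℤ.* + n) ⟩
    - ⟦ + suc m ℤ.* + n ⟧ℤ           ≈⟨ -‿cong (pos-homo (suc m) n) ⟩
    - (⟦ + suc m ⟧ℤ * ⟦ + n ⟧ℤ)      ≈⟨ -‿distribˡ-* _ _ ⟩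
    ⟦ -[1+ m ] ⟧ℤ * ⟦ + n ⟧ℤ         ∎
  *-homo -[1+ m ] -[1+ n ] = begin
    ⟦ + suc m ℤ.* + suc n ⟧ℤ         ≈⟨ pos-homo (suc m) (suc n) ⟩
    ⟦ + suc m ⟧ℤ * ⟦ + suc n ⟧ℤ      ≈⟨ -‿involutive _ ⟨
    - - (⟦ + suc m ⟧ℤ * ⟦ + suc n ⟧ℤ) ≈⟨ -‿cong (-‿distribˡ-* _ _) ⟩
    - (⟦ -[1+ m ] ⟧ℤ * ⟦ + suc n ⟧ℤ) ≈⟨ -‿distribʳ-* _ _ ⟩
    ⟦ -[1+ m ] ⟧ℤ * ⟦ -[1+ n ] ⟧ℤ    ∎

  morphism : ℤ.+-*-rawRing -Raw-AlmostCommutative⟶ fromCommutativeRing R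
  morphism = record
    { ⟦_⟧ = ⟦_⟧ℤ ; +-homo = +-homo ; *-homo = *-homo ; -‿homo = neg-homo
    ; 0-homo = ≈-refl ; 1-homo = ≈-refl }

  ⟦⟧ℤ-≟ : ∀ i j → Maybe (⟦ i ⟧ℤ ≈ ⟦ j ⟧ℤ)
  ⟦⟧ℤ-≟ i j with i ℤ.≟ j
  ... | yes refl = just ≈-refl
  ... | no  _    = nothing

  open Solver ℤ.+-*-rawRing (fromCommutativeRing R) morphism ⟦⟧ℤ-≟ public
    using (solve; _:=_; _:+_; _:*_; _:-_; :-_; con)

-- Characteristic and Frobenius

prime>1 : ∀ {p} → Prime p → 1 ℕ.< p
prime>1 pr = ℕ.nonTrivial⇒n>1 _ {{prime⇒nonTrivial pr}}

prime∤1 : ∀ {p} → Prime p → ¬ p ∣ 1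
prime∤1 pr p∣1 = ℕₚ.<-irrefl (sym (∣1⇒≡1 p∣1)) (prime>1 pr)

prime∣!⇒≤ : ∀ {p} → Prime p → ∀ k → p ∣ k ! → p ℕ.≤ k
prime∣!⇒≤ pr zero    p∣ = contradiction p∣ (prime∤1 pr)
prime∣!⇒≤ pr (suc k) p∣ with euclidsLemma (suc k) (k !) pr p∣
... | inj₁ p∣1+k = ∣⇒≤ p∣1+k
... | inj₂ p∣k!  = ℕₚ.m≤n⇒m≤1+n (prime∣!⇒≤ pr k p∣k!)

-- `p` divides `p ! = k ! * (p - k) ! * (p C k)` but neither of the two factorials, because `k` and
-- `p - k` are both below `p`.
prime∣C : ∀ {p} → Prime p → ∀ {k} → 0 ℕ.< k → k ℕ.< p → p ∣ p C k
prime∣C {suc p} pr {k} 0<k k<p with euclidsLemma (k ! ℕ.* (suc p ℕ.∸ k) !) (suc p C k) pr p∣product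
  where
  instance
    _ : NonZero (k ! ℕ.* (suc p ℕ.∸ k) !)
    _ = ℕₚ._!*_!≢0 k (suc p ℕ.∸ k)
  p∣product : suc p ∣ k ! ℕ.* (suc p ℕ.∸ k) ! ℕ.* (suc p C k)
  p∣product = subst (suc p ∣_)
    (sym (trans (cong (k ! ℕ.* (suc p ℕ.∸ k) ! ℕ.*_) (nCk≡n!/k![n-k]! (ℕₚ.<⇒≤ k<p)))
                (m*[n/m]≡n (k![n∸k]!∣n! (ℕₚ.<⇒≤ k<p)))))
    (m∣m*n (p !))
... | inj₂ p∣C = p∣C
... | inj₁ p∣k![p-k]! with euclidsLemma (k !) ((suc p ℕ.∸ k) !) pr p∣k![p-k]!
...   | inj₁ p∣k!     = contradiction (prime∣!⇒≤ pr k p∣k!) (ℕₚ.<⇒≱ k<p)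
...   | inj₂ p∣[p-k]! = contradiction (prime∣!⇒≤ pr (suc p ℕ.∸ k) p∣[p-k]!) (ℕₚ.<⇒≱ (ℕₚ.∸-monoʳ-< 0<k (ℕₚ.<⇒≤ k<p)))

module FieldTheory {p n : ℕ} .{{_ : NonZero p}} (pr : Prime p) (F : FiniteField p n) where
  open FiniteField F public hiding (zeroFin) renaming (_≟_ to infix 4 _≟_; -_ to infix 8 -_)
  open ≡-Reasoning

  q : ℕ
  q = p ^ n

  R : CommutativeRing 0ℓ 0ℓ
  R = record { isCommutativeRing = isCommutativeRing }

  open CommutativeRing R public
    using (+-comm; +-assoc; +-identityˡ; +-identityʳ; *-comm; *-assoc; *-identityˡ; *-identityʳ;
           zeroˡ; zeroʳ; distribˡ; distribʳ; -‿inverseˡ; -‿inverseʳ; +-commutativeMonoid; *-commutativeMonoid;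
           semiring; commutativeSemiring; ring)
  open import Algebra.Properties.Ring ring public
    using (-0#≈0#; -‿distribˡ-*; -‿distribʳ-*; -‿involutive)
  open IntegerCoefficients R public using (solve; _:=_; _:+_; _:*_; _:-_; :-_; con)

  x-y≡0⇒x≡y : ∀ x y → x - y ≡ 0# → x ≡ y
  x-y≡0⇒x≡y x y eq = begin
    x             ≡⟨ solve 2 (λ x y → x := (x :- y) :+ y) refl x y ⟩
    (x - y) + y   ≡⟨ cong (_+ y) eq ⟩
    0# + y        ≡⟨ +-identityˡ y ⟩
    y             ∎

  x≡y⇒x-y≡0 : ∀ {x y} → x ≡ y → x - y ≡ 0#
  x≡y⇒x-y≡0 {x} refl = -‿inverseʳ x

  *-nonzero-cancelˡ : ∀ x {y z} → x ≢ 0# → x * y ≡ x * z → y ≡ z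
  *-nonzero-cancelˡ x {y} {z} x≢0 eq with inverse x x≢0
  ... | x⁻¹ , xx⁻¹ = begin
    y               ≡⟨ undo y ⟩
    x⁻¹ * (x * y)   ≡⟨ cong (x⁻¹ *_) eq ⟩
    x⁻¹ * (x * z)   ≡⟨ undo z ⟨
    z               ∎
    where
    undo : ∀ w → w ≡ x⁻¹ * (x * w)
    undo w = begin
      w               ≡⟨ *-identityˡ w ⟨
      1# * w          ≡⟨ cong (_* w) xx⁻¹ ⟨
      x * x⁻¹ * w     ≡⟨ solve 3 (λ x i w → x :* i :* w := i :* (x :* w)) refl x x⁻¹ w ⟩
      x⁻¹ * (x * w)   ∎

  *-zero-factor : ∀ x {y} → x ≢ 0# → x * y ≡ 0# → y ≡ 0#
  *-zero-factor x x≢0 eq = *-nonzero-cancelˡ x x≢0 (trans eq (sym (zeroʳ x)))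

  *-nonzero : ∀ {x y} → x ≢ 0# → y ≢ 0# → x * y ≢ 0#
  *-nonzero {x} x≢0 y≢0 eq = y≢0 (*-zero-factor x x≢0 eq)

  pow-+ : ∀ x a b → pow x (a ℕ.+ b) ≡ pow x a * pow x b
  pow-+ x zero    b = sym (*-identityˡ _)
  pow-+ x (suc a) b = trans (cong (x *_) (pow-+ x a b)) (sym (*-assoc x _ _))

  pow-distrib-* : ∀ x y a → pow (x * y) a ≡ pow x a * pow y a
  pow-distrib-* x y zero    = sym (*-identityˡ 1#)
  pow-distrib-* x y (suc a) = trans (cong (x * y *_) (pow-distrib-* x y a))
    (solve 4 (λ x y u v → x :* y :* (u :* v) := x :* u :* (y :* v)) refl x y _ _)

  pow-1# : ∀ a → pow 1# a ≡ 1#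
  pow-1# zero    = refl
  pow-1# (suc a) = trans (*-identityˡ _) (pow-1# a)

  pow-1 : ∀ x → pow x 1 ≡ x
  pow-1 x = *-identityʳ x

  pow-* : ∀ x a b → pow x (a ℕ.* b) ≡ pow (pow x b) a
  pow-* x zero    b = refl
  pow-* x (suc a) b = trans (pow-+ x b (a ℕ.* b)) (cong (pow x b *_) (pow-* x a b))

  pow-0# : ∀ a → 0 ℕ.< a → pow 0# a ≡ 0#
  pow-0# (suc a) _ = zeroˡ _

  pow≡0⇒≡0 : ∀ x a → pow x a ≡ 0# → x ≡ 0#
  pow≡0⇒≡0 x zero    eq = contradiction (sym eq) 0≢1
  pow≡0⇒≡0 x (suc a) eq with x ≟ 0#
  ... | yes x≡0 = x≡0
  ... | no  x≢0 = pow≡0⇒≡0 x a (*-zero-factor x x≢0 eq)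

  ι-+ : ∀ a b → ι (a ℕ.+ b) ≡ ι a + ι b
  ι-+ zero    b = sym (+-identityˡ _)
  ι-+ (suc a) b = trans (cong (1# +_) (ι-+ a b)) (sym (+-assoc 1# _ _))

  ι-* : ∀ a b → ι (a ℕ.* b) ≡ ι a * ι b
  ι-* zero    b = sym (zeroˡ _)
  ι-* (suc a) b = trans (ι-+ b (a ℕ.* b)) (trans (cong (ι b +_) (ι-* a b))
    (solve 2 (λ u v → v :+ u :* v := (con (ℤ.+ 1) :+ u) :* v) refl (ι a) (ι b)))

  ι-^ : ∀ a b → ι (a ^ b) ≡ pow (ι a) b
  ι-^ a zero    = +-identityʳ 1#
  ι-^ a (suc b) = trans (ι-* a (a ^ b)) (cong (ι a *_) (ι-^ a b))

  ι-1 : ι 1 ≡ 1#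
  ι-1 = +-identityʳ 1#

  module Sum⁺ = Summation enum +-commutativeMonoid
  module Sum* = Summation enum *-commutativeMonoid

  +-cancelˡ-0 : ∀ x y → x ≡ x + y → y ≡ 0#
  +-cancelˡ-0 x y eq = begin
    y             ≡⟨ solve 2 (λ x y → y := (x :+ y) :- x) refl x y ⟩
    (x + y) - x   ≡⟨ cong (_- x) eq ⟨
    x - x         ≡⟨ -‿inverseʳ x ⟩
    0#            ∎

  open import Algebra.Properties.CommutativeMonoid.Sum +-commutativeMonoid using (sum)
  open import Algebra.Properties.CommutativeMonoid.Sum *-commutativeMonoid using () renaming (sum to prod)

  sum-1# : ∀ m → sum {m} (λ _ → 1#) ≡ ι m
  sum-1# zero    = refl
  sum-1# (suc m) = cong (_+_ 1#) (sum-1# m)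

  prod-const : ∀ m a → prod {m} (λ _ → a) ≡ pow a m
  prod-const zero    a = refl
  prod-const (suc m) a = cong (a *_) (prod-const m a)

  -- Translation by 1 permutes the field, so Σ x = Σ (x + 1) = Σ x + q·1.
  ι-q : ι q ≡ 0#
  ι-q = +-cancelˡ-0 (∑ id) (ι q) (begin
    ∑ id                     ≡⟨ ∑-reindex id (_+ 1#) (_- 1#)
                                 (λ x → solve 1 (λ x → x :- con (ℤ.+ 1) :+ con (ℤ.+ 1) := x) refl x)
                                 (λ x → solve 1 (λ x → x :+ con (ℤ.+ 1) :- con (ℤ.+ 1) := x) refl x) ⟩
    ∑ (_+ 1#)                ≡⟨ ∑-distrib id (λ _ → 1#) ⟩
    ∑ id + ∑ (λ _ → 1#)      ≡⟨ cong (∑ id +_) (sum-1# q) ⟩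
    ∑ id + ι q               ∎)
    where open Sum⁺

  -- `ι q` is the `n`-th power of `ι p`, and a field has no nilpotent elements other than 0.
  ι-p : ι p ≡ 0#
  ι-p = pow≡0⇒≡0 (ι p) n (trans (sym (ι-^ p n)) ι-q)

  ι-multiple : ∀ {m} → p ∣ m → ι m ≡ 0#
  ι-multiple (divides k refl) = trans (ι-* k p) (trans (cong (ι k *_) ι-p) (zeroʳ _))

  -- Otherwise `p` and `m` are coprime, and a Bézout identity writes 1 through two numbers that `ι`
  -- sends to 0.
  ι≡0⇒p∣ : ∀ {m} → ι m ≡ 0# → p ∣ m
  ι≡0⇒p∣ {m} ιm≡0 with p ∣? m
  ... | yes p∣m = p∣m
  ... | no p∤m = contradiction (one (coprime-Bézout coprime)) λ 1≡0 → 0≢1 (sym 1≡0)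
    where
    coprime : Coprime p m
    coprime {d} (d∣p , d∣m) with prime⇒irreducible pr d∣p
    ... | inj₁ d≡1 = d≡1
    ... | inj₂ refl = contradiction d∣m p∤m
    vanish : ∀ k {j} → ι j ≡ 0# → ι (k ℕ.* j) ≡ 0#
    vanish k eq = trans (ι-* k _) (trans (cong (ι k *_) eq) (zeroʳ _))
    one : Bézout.Identity 1 p m → 1# ≡ 0#
    one (Bézout.+- x y eq) = begin
      1#                      ≡⟨ +-identityʳ 1# ⟨
      1# + 0#                 ≡⟨ cong (1# +_) (vanish y ιm≡0) ⟨
      ι (1 ℕ.+ y ℕ.* m)       ≡⟨ cong ι eq ⟩
      ι (x ℕ.* p)             ≡⟨ vanish x ι-p ⟩
      0#                      ∎
    one (Bézout.-+ x y eq) = begin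
      1#                      ≡⟨ +-identityʳ 1# ⟨
      1# + 0#                 ≡⟨ cong (1# +_) (vanish x ι-p) ⟨
      ι (1 ℕ.+ x ℕ.* p)       ≡⟨ cong ι eq ⟩
      ι (y ℕ.* m)             ≡⟨ vanish y ιm≡0 ⟩
      0#                      ∎

  ι-% : ∀ m → ι (m % p) ≡ ι m
  ι-% m = sym (begin
    ι m                              ≡⟨ cong ι (m≡m%n+[m/n]*n m p) ⟩
    ι (m % p ℕ.+ (m / p) ℕ.* p)      ≡⟨ ι-+ (m % p) _ ⟩
    ι (m % p) + ι ((m / p) ℕ.* p)    ≡⟨ cong (ι (m % p) +_) (ι-multiple (n∣m*n (m / p))) ⟩
    ι (m % p) + 0#                   ≡⟨ +-identityʳ _ ⟩
    ι (m % p)                        ∎)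

  ι-mod : ∀ m → embedFp (m mod p) ≡ ι m
  ι-mod m = trans (cong ι (FinP.toℕ-fromℕ< (m%n<n m p))) (ι-% m)

  ι-∸ : ∀ {a b} → a ℕ.≤ b → ι (b ℕ.∸ a) ≡ ι b - ι a
  ι-∸ {a} {b} a≤b = begin
    ι (b ℕ.∸ a)                   ≡⟨ solve 2 (λ x y → x := x :+ y :- y) refl _ (ι a) ⟩
    ι (b ℕ.∸ a) + ι a - ι a       ≡⟨ cong (_- ι a) (ι-+ (b ℕ.∸ a) a) ⟨
    ι (b ℕ.∸ a ℕ.+ a) - ι a       ≡⟨ cong (λ m → ι m - ι a) (ℕₚ.m∸n+n≡m a≤b) ⟩
    ι b - ι a                     ∎

  -- The representatives differ by a multiple of `p` that is smaller than `p`.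
  embedFp-≤ : ∀ {i j} → toℕ i ℕ.≤ toℕ j → embedFp i ≡ embedFp j → i ≡ j
  embedFp-≤ {i} {j} i≤j eq with toℕ j ℕ.∸ toℕ i in d≡
  ... | zero  = FinP.toℕ-injective (ℕₚ.≤-antisym i≤j (ℕₚ.m∸n≡0⇒m≤n d≡))
  ... | suc d = contradiction (∣⇒≤ p∣1+d) (ℕₚ.<⇒≱ (subst (ℕ._< p) d≡ (ℕₚ.≤-<-trans (ℕₚ.m∸n≤m (toℕ j) (toℕ i)) (FinP.toℕ<n j))))
    where
    p∣1+d : p ∣ suc d
    p∣1+d = ι≡0⇒p∣ (trans (cong ι (sym d≡)) (trans (ι-∸ i≤j) (x≡y⇒x-y≡0 (sym eq))))

  embedFp-injective : ∀ {i j} → embedFp i ≡ embedFp j → i ≡ j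
  embedFp-injective {i} {j} eq with ℕₚ.≤-total (toℕ i) (toℕ j)
  ... | inj₁ i≤j = embedFp-≤ i≤j eq
  ... | inj₂ j≤i = sym (embedFp-≤ j≤i (sym eq))

  -- Multiplication by a ≠ 0 permutes the non-zero elements, so their
  -- product is unchanged; the zero element is replaced by the factor 1.
  pow-q : ∀ a → pow a q ≡ a
  pow-q a with a ≟ 0#
  ... | yes refl = pow-0# q (ℕₚ.m^n>0 p n)
  ... | no a≢0 with inverse a a≢0
  ...   | a⁻¹ , aa⁻¹ = begin
    pow a q                              ≡⟨ prod-const q a ⟨
    ∑ (λ _ → a)                          ≡⟨ ∑-cong split ⟩
    ∑ (λ x → factor x * atZero x)        ≡⟨ ∑-distrib factor atZero ⟩
    ∑ factor * ∑ atZero                  ≡⟨ cong₂ _*_ ∑factor≡1 ∑atZero≡a ⟩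
    1# * a                               ≡⟨ *-identityˡ a ⟩
    a                                    ∎
    where
    open Sum*
    nz : Carrier → Carrier
    nz x with x ≟ 0#
    ... | yes _ = 1#
    ... | no  _ = x
    -- The product of `factor` is a^(q-1), and `atZero` supplies the one remaining `a`; this avoids
    -- the subtraction in the exponent.
    factor atZero : Carrier → Carrier
    factor x with x ≟ 0#
    ... | yes _ = 1#
    ... | no  _ = a
    atZero x with x ≟ 0#
    ... | yes _ = a
    ... | no  _ = 1#
    split : ∀ x → a ≡ factor x * atZero x
    split x with x ≟ 0#
    ... | yes _ = sym (*-identityˡ a)
    ... | no  _ = sym (*-identityʳ a)
    nz≢0 : ∀ x → nz x ≢ 0#
    nz≢0 x with x ≟ 0#
    ... | yes _  = λ eq → 0≢1 (sym eq)
    ... | no x≢0 = x≢0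
    nz-scale : ∀ x → nz (a * x) ≡ factor x * nz x
    nz-scale x with x ≟ 0# | (a * x) ≟ 0#
    ... | yes _    | yes _    = sym (*-identityˡ 1#)
    ... | yes refl | no ax≢0  = contradiction (zeroʳ a) ax≢0
    ... | no x≢0   | yes ax≡0 = contradiction ax≡0 (*-nonzero a≢0 x≢0)
    ... | no _     | no _     = refl
    prod≢0 : ∀ {m} (t : Fin m → Carrier) → (∀ i → t i ≢ 0#) → prod t ≢ 0#
    prod≢0 {zero}  t t≢0 = λ eq → 0≢1 (sym eq)
    prod≢0 {suc m} t t≢0 = *-nonzero (t≢0 Fin.zero) (prod≢0 (t ∘ Fin.suc) (t≢0 ∘ Fin.suc))
    ∑factor≡1 : ∑ factor ≡ 1#
    ∑factor≡1 = *-nonzero-cancelˡ (∑ nz) (prod≢0 (nz ∘ Inverse.to enum) (λ _ → nz≢0 _)) (begin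
      ∑ nz * ∑ factor            ≡⟨ *-comm _ _ ⟩
      ∑ factor * ∑ nz            ≡⟨ ∑-distrib factor nz ⟨
      ∑ (λ x → factor x * nz x)  ≡⟨ ∑-cong nz-scale ⟨
      ∑ (λ x → nz (a * x))       ≡⟨ ∑-reindex nz (a *_) (a⁻¹ *_)
                                      (λ x → trans (sym (*-assoc a a⁻¹ x)) (trans (cong (_* x) aa⁻¹) (*-identityˡ x)))
                                      (λ x → trans (sym (*-assoc a⁻¹ a x)) (trans (cong (_* x) (trans (*-comm a⁻¹ a) aa⁻¹)) (*-identityˡ x))) ⟨
      ∑ nz                       ≡⟨ *-identityʳ _ ⟨
      ∑ nz * 1#                  ∎)
    atZero-0 : atZero 0# ≡ a
    atZero-0 with 0# ≟ 0#
    ... | yes _  = refl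
    ... | no 0≢0 = contradiction refl 0≢0
    ∑atZero≡a : ∑ atZero ≡ a
    ∑atZero≡a = trans (∑-point 0# atZero off) atZero-0
      where
      off : ∀ x → x ≢ 0# → atZero x ≡ 1#
      off x x≢0 with x ≟ 0#
      ... | yes x≡0 = contradiction x≡0 x≢0
      ... | no _    = refl

  open import Algebra.Properties.Semiring.Exp semiring using () renaming (_^_ to _^ᴿ_)
  open import Algebra.Properties.Semiring.Mult semiring using () renaming (_×_ to _×ᴿ_)
  import Algebra.Properties.CommutativeSemiring.Binomial commutativeSemiring as Binomial

  ^≡pow : ∀ x a → x ^ᴿ a ≡ pow x a
  ^≡pow x zero    = refl
  ^≡pow x (suc a) = cong (x *_) (^≡pow x a)

  ×≡ι* : ∀ a x → a ×ᴿ x ≡ ι a * x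
  ×≡ι* zero    x = sym (zeroˡ x)
  ×≡ι* (suc a) x = trans (cong (x +_) (×≡ι* a x))
    (solve 2 (λ u x → x :+ u :* x := (con (ℤ.+ 1) :+ u) :* x) refl (ι a) x)

  private
    -- In the binomial expansion all inner coefficients are multiples of `p`. The parameter `m`
    -- exposes `p` as a successor, so that the last term has the index `fromℕ m` among those left
    -- after the first is split off.
    freshman : ∀ m → p ≡ suc m → ∀ x y → pow (x + y) p ≡ pow x p + pow y p
    freshman m refl x y = begin
      pow (x + y) p             ≡⟨ ^≡pow (x + y) p ⟨
      (x + y) ^ᴿ p              ≡⟨ Binomial.theorem p x y ⟩
      t Fin.zero + sum (t ∘ Fin.suc)
        ≡⟨ cong₂ _+_ first (Sum⁺.sum-point (t ∘ Fin.suc) (fromℕ m) middle) ⟩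
      pow y p + t (fromℕ p)     ≡⟨ cong (pow y p +_) last ⟩
      pow y p + pow x p         ≡⟨ +-comm _ _ ⟩
      pow x p + pow y p         ∎
      where
      t : Fin (suc p) → Carrier
      t = Binomial.binomialTerm x y p
      first : t Fin.zero ≡ pow y p
      first = begin
        1 ×ᴿ (1# * y ^ᴿ p)   ≡⟨ ×≡ι* 1 _ ⟩
        ι 1 * (1# * y ^ᴿ p)  ≡⟨ cong₂ (λ a b → a * (1# * b)) ι-1 (^≡pow y p) ⟩
        1# * (1# * pow y p)  ≡⟨ trans (*-identityˡ _) (*-identityˡ _) ⟩
        pow y p              ∎
      last : t (fromℕ p) ≡ pow x p
      last = begin
        t (fromℕ p)
          ≡⟨ cong (λ k → (p C k) ×ᴿ (x ^ᴿ k * y ^ᴿ (p ℕ.∸ k))) (FinP.toℕ-fromℕ p) ⟩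
        (p C p) ×ᴿ (x ^ᴿ p * y ^ᴿ (p ℕ.∸ p))
          ≡⟨ cong₂ (λ c k → c ×ᴿ (x ^ᴿ p * y ^ᴿ k)) (nCn≡1 p) (ℕₚ.n∸n≡0 p) ⟩
        1 ×ᴿ (x ^ᴿ p * 1#)
          ≡⟨ trans (×≡ι* 1 _) (cong₂ _*_ ι-1 (trans (*-identityʳ _) (^≡pow x p))) ⟩
        1# * pow x p
          ≡⟨ *-identityˡ _ ⟩
        pow x p ∎
      middle : ∀ j → j ≢ fromℕ m → t (Fin.suc j) ≡ 0#
      middle j j≢m = trans (×≡ι* (p C suc (toℕ j)) _)
        (trans (cong (_* Binomial.binomial x y p (Fin.suc j)) (ι-multiple (prime∣C pr (s≤s z≤n) 1+j<p))) (zeroˡ _))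
        where
        1+j<p : suc (toℕ j) ℕ.< p
        1+j<p = s≤s (ℕₚ.≤∧≢⇒< (ℕₚ.≤-pred (FinP.toℕ<n j))
          (λ eq → j≢m (FinP.toℕ-injective (trans eq (sym (FinP.toℕ-fromℕ m))))))

  pow-p-+ : ∀ x y → pow (x + y) p ≡ pow x p + pow y p
  pow-p-+ = freshman (ℕ.pred p) (sym (ℕₚ.suc-pred p))

  -- Powers of the Frobenius map: `φ k` is σ^k

  φ : ℕ → Carrier → Carrier
  φ k x = pow x (p ^ k)

  φ-0 : ∀ x → φ 0 x ≡ x
  φ-0 = pow-1

  φ-suc : ∀ k x → φ (suc k) x ≡ pow (φ k x) p
  φ-suc k x = pow-* x p (p ^ k)

  φ-+ : ∀ k x y → φ k (x + y) ≡ φ k x + φ k y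
  φ-+ zero    x y = trans (φ-0 _) (sym (cong₂ _+_ (φ-0 x) (φ-0 y)))
  φ-+ (suc k) x y = begin
    φ (suc k) (x + y)              ≡⟨ φ-suc k _ ⟩
    pow (φ k (x + y)) p            ≡⟨ cong (λ z → pow z p) (φ-+ k x y) ⟩
    pow (φ k x + φ k y) p          ≡⟨ pow-p-+ _ _ ⟩
    pow (φ k x) p + pow (φ k y) p  ≡⟨ cong₂ _+_ (φ-suc k x) (φ-suc k y) ⟨
    φ (suc k) x + φ (suc k) y      ∎

  φ-* : ∀ k x y → φ k (x * y) ≡ φ k x * φ k y
  φ-* k x y = pow-distrib-* x y (p ^ k)

  φ-0# : ∀ k → φ k 0# ≡ 0#
  φ-0# k = pow-0# (p ^ k) (ℕₚ.m^n>0 p k)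

  φ-1# : ∀ k → φ k 1# ≡ 1#
  φ-1# k = pow-1# (p ^ k)

  φ-neg : ∀ k x → φ k (- x) ≡ - φ k x
  φ-neg k x = begin
    φ k (- x)                      ≡⟨ solve 2 (λ a b → b := (a :+ b) :- a) refl (φ k x) (φ k (- x)) ⟩
    (φ k x + φ k (- x)) - φ k x    ≡⟨ cong (_- φ k x) (φ-+ k x (- x)) ⟨
    φ k (x - x) - φ k x            ≡⟨ cong (λ z → φ k z - φ k x) (-‿inverseʳ x) ⟩
    φ k 0# - φ k x                 ≡⟨ cong (_- φ k x) (φ-0# k) ⟩
    0# - φ k x                     ≡⟨ +-identityˡ _ ⟩
    - φ k x                        ∎

  φ-sub : ∀ k x y → φ k (x - y) ≡ φ k x - φ k y
  φ-sub k x y = trans (φ-+ k x (- y)) (cong (φ k x +_) (φ-neg k y))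

  φ-∘ : ∀ j k x → φ j (φ k x) ≡ φ (j ℕ.+ k) x
  φ-∘ j k x = trans (sym (pow-* x (p ^ j) (p ^ k))) (cong (pow x) (sym (ℕₚ.^-distribˡ-+-* p j k)))

  φ-comm : ∀ j k x → φ j (φ k x) ≡ φ k (φ j x)
  φ-comm j k x = trans (φ-∘ j k x) (trans (cong (λ i → φ i x) (ℕₚ.+-comm j k)) (sym (φ-∘ k j x)))

  φ-n : ∀ x → φ n x ≡ x
  φ-n = pow-q

  φ-ι : ∀ k m → φ k (ι m) ≡ ι m
  φ-ι k zero    = φ-0# k
  φ-ι k (suc m) = trans (φ-+ k 1# (ι m)) (cong₂ _+_ (φ-1# k) (φ-ι k m))

  φ-fixed-* : ∀ a k x → φ a x ≡ x → φ (k ℕ.* a) x ≡ x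
  φ-fixed-* a zero    x fix = φ-0 x
  φ-fixed-* a (suc k) x fix = trans (sym (φ-∘ a (k ℕ.* a) x)) (trans (cong (φ a) (φ-fixed-* a k x fix)) fix)

  φ-n* : ∀ k x → φ (k ℕ.* n) x ≡ x
  φ-n* k x = φ-fixed-* n k x (φ-n x)

  -- By additivity the difference `x - y` has `p ^ k`-th power 0.
  φ-injective : ∀ k {x y} → φ k x ≡ φ k y → x ≡ y
  φ-injective k {x} {y} eq = x-y≡0⇒x≡y x y (pow≡0⇒≡0 (x - y) (p ^ k) (trans (φ-sub k x y) (x≡y⇒x-y≡0 eq)))

-- Root counting and the trace

-- The search inside Tr is private to Defs; unification recovers it here.
mutual
  findFp : ∀ {p n} .{{_ : NonZero p}} (F : FiniteField p n) → FiniteField.Carrier F → List (Fin p) → Fin p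
  findFp = _

  Tr≡findFp : ∀ {p n} .{{_ : NonZero p}} (F : FiniteField p n) x →
              FiniteField.Tr F x ≡ findFp F (FiniteField.trElt F x) (allFin p)
  Tr≡findFp {p} F x with FiniteField.trElt F x | allFin p
  ... | y | ks = refl

-- Since the list contains a solution, the default value of `Tr` is never reached. The search stops
-- at the first hit, which need not be `k` itself, so only its image is described.
findFp-correct : ∀ {p n} .{{_ : NonZero p}} (F : FiniteField p n) {y k} ks → k ∈ ks →
                 FiniteField.embedFp F k ≡ y → FiniteField.embedFp F (findFp F y ks) ≡ y
findFp-correct F {y} (j ∷ ks) k∈ eq with FiniteField._≟_ F (FiniteField.embedFp F j) y
findFp-correct F (j ∷ ks) k∈         eq | yes found = found
findFp-correct F (j ∷ ks) (here refl) eq | no ≢y     = contradiction eq ≢y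
findFp-correct F (j ∷ ks) (there k∈) eq | no _      = findFp-correct F ks k∈ eq

module TraceTheory {p n : ℕ} .{{_ : NonZero p}} (pr : Prime p) (1≤n : 1 ℕ.≤ n) (F : FiniteField p n) where
  open FieldTheory pr F public
  open ≡-Reasoning

  search : ∀ {P : Carrier → Set} → Decidable P → (∃ P) ⊎ (∀ x → ¬ P x)
  search {P} P? with FinP.any? (P? ∘ Inverse.to enum)
  ... | yes (i , Pi) = inj₁ (_ , Pi)
  ... | no ¬∃        = inj₂ λ x Px → ¬∃ (Inverse.from enum x , subst P (sym (Inverse.strictlyInverseˡ enum x)) Px)

  -- Functions given by a polynomial of degree below `m`, in Horner form. The bound belongs to the
  -- representation and not to the function, since over a finite field different polynomials can
  -- define the same function.
  Poly< : ℕ → (Carrier → Carrier) → Set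
  Poly< zero    f = ∀ x → f x ≡ 0#
  Poly< (suc m) f = ∃ λ c → ∃ λ g → Poly< m g × (∀ x → f x ≡ c + x * g x)

  Monic : ℕ → (Carrier → Carrier) → Set
  Monic m f = ∃ λ g → Poly< m g × (∀ x → f x ≡ pow x m + g x)

  Poly<-cong : ∀ m {f g} → (∀ x → f x ≡ g x) → Poly< m f → Poly< m g
  Poly<-cong zero    eq f≡0              = λ x → trans (sym (eq x)) (f≡0 x)
  Poly<-cong (suc m) eq (c , h , Ph , f≡) = c , h , Ph , λ x → trans (sym (eq x)) (f≡ x)

  Poly<-0# : ∀ m → Poly< m (λ _ → 0#)
  Poly<-0# zero    = λ _ → refl
  Poly<-0# (suc m) = 0# , (λ _ → 0#) , Poly<-0# m , λ x → sym (trans (+-identityˡ _) (zeroʳ x))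

  Poly<-+ : ∀ m {f g} → Poly< m f → Poly< m g → Poly< m (λ x → f x + g x)
  Poly<-+ zero    f≡0 g≡0 = λ x → trans (cong₂ _+_ (f≡0 x) (g≡0 x)) (+-identityˡ 0#)
  Poly<-+ (suc m) (c , f′ , Pf′ , f≡) (d , g′ , Pg′ , g≡) =
    c + d , (λ x → f′ x + g′ x) , Poly<-+ m Pf′ Pg′ , λ x → trans (cong₂ _+_ (f≡ x) (g≡ x))
      (solve 5 (λ c d x u v → (c :+ x :* u) :+ (d :+ x :* v) := (c :+ d) :+ x :* (u :+ v)) refl c d x _ _)

  Poly<-scale : ∀ m a {f} → Poly< m f → Poly< m (λ x → a * f x)
  Poly<-scale zero    a f≡0 = λ x → trans (cong (a *_) (f≡0 x)) (zeroʳ a)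
  Poly<-scale (suc m) a (c , f′ , Pf′ , f≡) =
    a * c , (λ x → a * f′ x) , Poly<-scale m a Pf′ , λ x → trans (cong (a *_) (f≡ x))
      (solve 4 (λ a c x u → a :* (c :+ x :* u) := a :* c :+ x :* (a :* u)) refl a c x _)

  Poly<-neg : ∀ m {f} → Poly< m f → Poly< m (λ x → - f x)
  Poly<-neg m Pf = Poly<-cong m (λ x → solve 1 (λ y → (:- con (ℤ.+ 1)) :* y := :- y)
       refl _) (Poly<-scale m (- 1#) Pf)

  Poly<-pow : ∀ {m k} → k ℕ.< m → Poly< m (λ x → pow x k)
  Poly<-pow {suc m} {zero}  _         = 1# , (λ _ → 0#) , Poly<-0# m , λ x → sym (trans (cong (1# +_) (zeroʳ x)) (+-identityʳ 1#))
  Poly<-pow {suc m} {suc k} (s≤s k<m) = 0# , (λ x → pow x k) , Poly<-pow k<m , λ x → sym (+-identityˡ _)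

  Poly<-id : ∀ {m} → 1 ℕ.< m → Poly< m id
  Poly<-id {m} 1<m = Poly<-cong m pow-1 (Poly<-pow 1<m)

  Poly<-suc : ∀ m {f} → Poly< m f → Poly< (suc m) f
  Poly<-suc zero    f≡0 = 0# , (λ _ → 0#) , (λ _ → refl) , λ x → trans (f≡0 x) (sym (trans (+-identityˡ _) (zeroʳ x)))
  Poly<-suc (suc m) (c , f′ , Pf′ , f≡) = c , f′ , Poly<-suc m Pf′ , f≡

  -- Division by `x - a` in Horner form: for `f = c + x h` the difference is
  -- `(x - a) * h x + a * (h x - h a)`, and the induction hypothesis divides the second term.
  Poly<-quotient : ∀ m {f} → Poly< (suc m) f → ∀ a → ∃ λ g → Poly< m g × (∀ x → f x - f a ≡ (x - a) * g x)
  Poly<-quotient zero {f} (c , h , h≡0 , f≡) a = (λ _ → 0#) , (λ _ → refl) , λ x → begin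
    f x - f a                         ≡⟨ cong₂ _-_ (const x) (const a) ⟩
    c - c                             ≡⟨ -‿inverseʳ c ⟩
    0#                                ≡⟨ zeroʳ _ ⟨
    (x - a) * 0#                      ∎
    where
    const : ∀ x → f x ≡ c
    const x = trans (f≡ x) (trans (cong (λ z → c + x * z) (h≡0 x)) (trans (cong (c +_) (zeroʳ x)) (+-identityʳ c)))
  Poly<-quotient (suc m) {f} (c , h , Ph , f≡) a with Poly<-quotient m Ph a
  ... | g , Pg , h≡ = (λ x → h x + a * g x) , Poly<-+ (suc m) Ph (Poly<-scale (suc m) a (Poly<-suc m Pg)) , λ x → begin
    f x - f a                               ≡⟨ cong₂ _-_ (f≡ x) (f≡ a) ⟩
    (c + x * h x) - (c + a * h a)
      ≡⟨ solve 5 (λ c x a u v → (c :+ x :* u) :- (c :+ a :* v) := (x :- a) :* u :+ a :* (u :- v))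
           refl c x a (h x) (h a) ⟩
    (x - a) * h x + a * (h x - h a)         ≡⟨ cong (λ z → (x - a) * h x + a * z) (h≡ x) ⟩
    (x - a) * h x + a * ((x - a) * g x)
      ≡⟨ solve 4 (λ d a u v → d :* u :+ a :* (d :* v) := d :* (u :+ a :* v)) refl (x - a) a (h x) (g x) ⟩
    (x - a) * (h x + a * g x)               ∎

  -- Splitting x x^m - a a^m as (x - a) x^m + a (x^m - a^m) keeps the leading power of the quotient
  -- visible; everything else is left to `Poly<-quotient`.
  Monic-quotient : ∀ m {f} → Monic (suc m) f → ∀ a → ∃ λ g → Monic m g × (∀ x → f x - f a ≡ (x - a) * g x)
  Monic-quotient m {f} (l , Pl , f≡) a with Poly<-quotient m Pl a | Poly<-quotient m (Poly<-pow (ℕₚ.n<1+n m)) a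
  ... | g , Pg , l≡ | h , Ph , pow≡ =
    (λ x → pow x m + (a * h x + g x)) ,
    ((λ x → a * h x + g x) , Poly<-+ m (Poly<-scale m a Ph) Pg , λ _ → refl) ,
    λ x → begin
    f x - f a
      ≡⟨ cong₂ _-_ (f≡ x) (f≡ a) ⟩
    (x * pow x m + l x) - (a * pow a m + l a)
      ≡⟨ solve 6 (λ x a u v s t → (x :* u :+ s) :- (a :* v :+ t) := (x :- a) :* u :+ (a :* (u :- v) :+ (s :- t)))
           refl x a (pow x m) (pow a m) (l x) (l a) ⟩
    (x - a) * pow x m + (a * (pow x m - pow a m) + (l x - l a))
      ≡⟨ cong₂ (λ y z → (x - a) * pow x m + (a * y + z)) (pow≡ x) (l≡ x) ⟩
    (x - a) * pow x m + (a * ((x - a) * h x) + (x - a) * g x)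
      ≡⟨ solve 5 (λ d a u s t → d :* u :+ (a :* (d :* s) :+ d :* t) := d :* (u :+ (a :* s :+ t)))
           refl (x - a) a (pow x m) (h x) (g x) ⟩
    (x - a) * (pow x m + (a * h x + g x)) ∎

  Monic-zero : ∀ {f} → Monic 0 f → ∀ x → f x ≢ 0#
  Monic-zero (g , g≡0 , f≡) x fx≡0 = 0≢1 (trans (sym fx≡0) (trans (f≡ x) (trans (cong (1# +_) (g≡0 x)) (+-identityʳ 1#))))

  -- After division by `x - a` for one root `a`, the other listed roots differ from `a` and are
  -- therefore roots of the quotient.
  roots-bound : ∀ m f → Monic m f → ∀ xs → Unique xs → All (λ x → f x ≡ 0#) xs → length xs ℕ.≤ m
  roots-bound m       f Mf []       _              _              = z≤n
  roots-bound zero    f Mf (a ∷ xs) _              (fa≡0 ∷ _)     = contradiction fa≡0 (Monic-zero Mf a)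
  roots-bound (suc m) f Mf (a ∷ xs) (a∉xs ∷ uniq) (fa≡0 ∷ roots) =
    s≤s (roots-bound m g Mg xs uniq (All.zipWith root (a∉xs , roots)))
    where
    quotient : ∃ λ g → Monic m g × (∀ x → f x - f a ≡ (x - a) * g x)
    quotient = Monic-quotient m Mf a
    g : Carrier → Carrier
    g = proj₁ quotient
    Mg : Monic m g
    Mg = proj₁ (proj₂ quotient)
    root : ∀ {x} → a ≢ x × f x ≡ 0# → g x ≡ 0#
    root {x} (a≢x , fx≡0) = *-zero-factor (x - a) (λ eq → a≢x (sym (x-y≡0⇒x≡y x a eq)))
      (trans (sym (proj₂ (proj₂ quotient) x)) (x≡y⇒x-y≡0 (trans fx≡0 (sym fa≡0))))

  -- This is the source of existence statements: it will give an element of non-zero trace and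
  -- elements of fixed fields outside F_p.
  Monic-nonroot : ∀ m {f} → Monic m f → m ℕ.< q → ∃ λ x → f x ≢ 0#
  Monic-nonroot m {f} Mf m<q with search (λ x → ¬? (f x ≟ 0#))
  ... | inj₁ found = found
  ... | inj₂ none  = contradiction (roots-bound m f Mf (map to (allFin q)) uniq roots) (ℕₚ.<⇒≱ (subst (m ℕ.<_) (sym len) m<q))
    where
    open Inverse enum using (to; from; strictlyInverseʳ)
    len : length (map to (allFin q)) ≡ q
    len = trans (List.length-map to (allFin q)) (List.length-tabulate id)
    uniq : Unique (map to (allFin q))
    uniq = Unique.map⁺ (λ {i} {j} eq → trans (sym (strictlyInverseʳ i)) (trans (cong from eq) (strictlyInverseʳ j))) (Unique.allFin⁺ q)
    roots : All (λ x → f x ≡ 0#) (map to (allFin q))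
    roots = All.universal (λ x → decidable-stable (f x ≟ 0#) (none x)) _

  1<p : 1 ℕ.< p
  1<p = prime>1 pr

  p^-mono-< : ∀ {j k} → j ℕ.< k → p ^ j ℕ.< p ^ k
  p^-mono-< = ℕₚ.^-monoʳ-< p 1<p

  Poly<-φ : ∀ {j k} → j ℕ.< k → Poly< (p ^ k) (φ j)
  Poly<-φ j<k = Poly<-pow (p^-mono-< j<k)

  φ-nonroot : ∀ {k g} → k ℕ.< n → Poly< (p ^ k) g → ∃ λ x → φ k x + g x ≢ 0#
  φ-nonroot {k} {g} k<n Pg = Monic-nonroot (p ^ k) (g , Pg , λ _ → refl) (p^-mono-< k<n)

  -- Sums along Frobenius orbits and the absolute trace

  S : (ℕ → Carrier) → ℕ → Carrier
  S g zero    = 0#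
  S g (suc m) = S g m + g m

  S-cong : ∀ {g h} → (∀ i → g i ≡ h i) → ∀ m → S g m ≡ S h m
  S-cong eq zero    = refl
  S-cong eq (suc m) = cong₂ _+_ (S-cong eq m) (eq m)

  S-+ : ∀ g h m → S (λ i → g i + h i) m ≡ S g m + S h m
  S-+ g h zero    = sym (+-identityˡ 0#)
  S-+ g h (suc m) = trans (cong (_+ (g m + h m)) (S-+ g h m))
    (solve 4 (λ a b c d → a :+ b :+ (c :+ d) := a :+ c :+ (b :+ d)) refl _ _ _ _)

  S-scale : ∀ a g m → S (λ i → a * g i) m ≡ a * S g m
  S-scale a g zero    = sym (zeroʳ a)
  S-scale a g (suc m) = trans (cong (_+ a * g m) (S-scale a g m)) (sym (distribˡ a _ _))

  S-φ : ∀ k g m → φ k (S g m) ≡ S (λ i → φ k (g i)) m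
  S-φ k g zero    = φ-0# k
  S-φ k g (suc m) = trans (φ-+ k _ _) (cong (_+ φ k (g m)) (S-φ k g m))

  S-shift : ∀ g m → g 0 + S (g ∘ suc) m ≡ S g m + g m
  S-shift g zero    = +-comm _ _
  S-shift g (suc m) = trans (sym (+-assoc _ _ _)) (cong (_+ g (suc m)) (S-shift g m))

  -- The shift trades `g 0` for `g m`. It applies whenever Frobenius moves the summands of a
  -- trace-like sum one step along a closed orbit.
  S-cyclic : ∀ g m → g m ≡ g 0 → S (g ∘ suc) m ≡ S g m
  S-cyclic g m eq = begin
    S (g ∘ suc) m               ≡⟨ solve 2 (λ a b → b := (a :+ b) :- a) refl (g 0) _ ⟩
    (g 0 + S (g ∘ suc) m) - g 0 ≡⟨ cong₂ _-_ (S-shift g m) (sym eq) ⟩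
    (S g m + g m) - g m         ≡⟨ solve 2 (λ a b → (b :+ a) :- a := b) refl (g m) _ ⟩
    S g m                       ∎

  Poly<-S : ∀ N (f : ℕ → Carrier → Carrier) m → (∀ {i} → i ℕ.< m → Poly< N (f i)) → Poly< N (λ x → S (λ i → f i x) m)
  Poly<-S N f zero    _  = Poly<-0# N
  Poly<-S N f (suc m) Pf = Poly<-+ N (Poly<-S N f m (Pf ∘ ℕₚ.m<n⇒m<1+n)) (Pf (ℕₚ.n<1+n m))

  sumF-tabulate : ∀ g m → sumF (tabulate {n = m} (g ∘ toℕ)) ≡ S g m
  sumF-tabulate g zero    = refl
  sumF-tabulate g (suc m) = trans (cong (g 0 +_) (sumF-tabulate (g ∘ suc) m)) (S-shift g m)

  -- The trace with values in the field itself, so that its algebra involves no reduction modulo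
  -- `p`; `embedFp-Tr` is the way back to `Tr`. The highest power of Frobenius comes last, which
  -- suits `φ-nonroot`.
  τ : Carrier → Carrier
  τ x = S (λ i → φ i x) n

  trElt≡τ : ∀ x → trElt x ≡ τ x
  trElt≡τ x = trans (cong sumF (List.map-tabulate {n = n} id (λ i → φ (toℕ i) x))) (sumF-tabulate (λ i → φ i x) n)

  τ-+ : ∀ x y → τ (x + y) ≡ τ x + τ y
  τ-+ x y = trans (S-cong (λ i → φ-+ i x y) n) (S-+ (λ i → φ i x) (λ i → φ i y) n)

  -- Membership in the prime field: `embedFp-Fixed` and `Fixed⇒Fp` identify these elements with the
  -- image of `embedFp`.
  Fixed : Carrier → Set
  Fixed x = φ 1 x ≡ x

  φ-Fixed : ∀ {x} → Fixed x → ∀ k → φ k x ≡ x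
  φ-Fixed {x} fix k = subst (λ i → φ i x ≡ x) (ℕₚ.*-identityʳ k) (φ-fixed-* 1 k x fix)

  τ-scale : ∀ {s} → Fixed s → ∀ x → τ (s * x) ≡ s * τ x
  τ-scale {s} fix x = trans
    (S-cong (λ i → trans (φ-* i s x) (cong (_* φ i x) (φ-Fixed fix i))) n)
    (S-scale s (λ i → φ i x) n)

  τ-0# : τ 0# ≡ 0#
  τ-0# = trans (cong τ (sym (zeroˡ 0#))) (trans (τ-scale (φ-0# 1) 0#) (zeroˡ _))

  Fixed-neg : ∀ {s} → Fixed s → Fixed (- s)
  Fixed-neg {s} fix = trans (φ-neg 1 s) (cong -_ fix)

  Fixed-* : ∀ {s t} → Fixed s → Fixed t → Fixed (s * t)
  Fixed-* {s} {t} fs ft = trans (φ-* 1 s t) (cong₂ _*_ fs ft)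

  Fixed-+ : ∀ {s t} → Fixed s → Fixed t → Fixed (s + t)
  Fixed-+ {s} {t} fs ft = trans (φ-+ 1 s t) (cong₂ _+_ fs ft)

  Fixed-inverse : ∀ {s t} → Fixed s → s ≢ 0# → s * t ≡ 1# → Fixed t
  Fixed-inverse {s} {t} fs s≢0 st≡1 = *-nonzero-cancelˡ s s≢0 (begin
    s * φ 1 t      ≡⟨ cong (_* φ 1 t) fs ⟨
    φ 1 s * φ 1 t  ≡⟨ φ-* 1 s t ⟨
    φ 1 (s * t)    ≡⟨ cong (φ 1) st≡1 ⟩
    φ 1 1#         ≡⟨ φ-1# 1 ⟩
    1#             ≡⟨ st≡1 ⟨
    s * t          ∎)

  τ-φ1 : ∀ x → τ (φ 1 x) ≡ τ x
  τ-φ1 x = trans (S-cong (λ i → trans (φ-∘ i 1 x) (cong (λ j → φ j x) (ℕₚ.+-comm i 1))) n)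
    (S-cyclic (λ i → φ i x) n (trans (φ-n x) (sym (φ-0 x))))

  τ-φ : ∀ k x → τ (φ k x) ≡ τ x
  τ-φ zero    x = cong τ (φ-0 x)
  τ-φ (suc k) x = trans (cong τ (sym (φ-∘ 1 k x))) (trans (τ-φ1 (φ k x)) (τ-φ k x))

  τ-Fixed : ∀ x → Fixed (τ x)
  τ-Fixed x = trans (S-φ 1 (λ i → φ i x) n) (trans (S-cong (λ i → φ-comm 1 i x) n) (τ-φ1 x))

  -- The trace is a monic polynomial function of degree p^(n-1), which is less than `q`.
  τ-nonzero : ∃ λ x → τ x ≢ 0#
  τ-nonzero = go n refl 1≤n
    where
    go : ∀ m → n ≡ m → 1 ℕ.≤ m → ∃ λ x → τ x ≢ 0#
    go (suc m) n≡1+m _ with φ-nonroot (subst (m ℕ.<_) (sym n≡1+m) (ℕₚ.n<1+n m)) (Poly<-S (p ^ m) φ m Poly<-φ)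
    ... | x , ≢0 = x , λ τx≡0 → ≢0 (trans (+-comm _ _) (trans (cong (S (λ i → φ i x)) (sym n≡1+m)) τx≡0))

  -- x^p - x has at most `p` roots, and the `p` distinct elements `embedFp k` already are roots; a
  -- further one would be too many.
  Fixed⇒Fp : ∀ {x} → Fixed x → ∃ λ k → embedFp k ≡ x
  Fixed⇒Fp {x} fix with FinP.any? (λ k → embedFp k ≟ x)
  ... | yes found = found
  ... | no ¬found = contradiction (roots-bound (p ^ 1) (λ y → φ 1 y - y) monic (x ∷ map embedFp (allFin p)) uniq roots)
      (ℕₚ.<⇒≱ (s≤s (ℕₚ.≤-reflexive (trans (ℕₚ.*-identityʳ p) (sym len)))))
    where
    monic : Monic (p ^ 1) (λ y → φ 1 y - y)
    monic = -_ , Poly<-neg (p ^ 1) (Poly<-id (subst (1 ℕ.<_) (sym (ℕₚ.*-identityʳ p)) 1<p)) , λ _ → refl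
    len : length (map embedFp (allFin p)) ≡ p
    len = trans (List.length-map embedFp (allFin p)) (List.length-tabulate id)
    uniq : Unique (x ∷ map embedFp (allFin p))
    uniq = All.map⁺ (All.universal (λ k x≡ → ¬found (k , sym x≡)) (allFin p)) ∷ Unique.map⁺ embedFp-injective (Unique.allFin⁺ p)
    roots : All (λ y → φ 1 y - y ≡ 0#) (x ∷ map embedFp (allFin p))
    roots = x≡y⇒x-y≡0 fix ∷ All.map⁺ (All.universal (λ k → x≡y⇒x-y≡0 (φ-ι 1 (toℕ k))) (allFin p))

  -- The trace lies in F_p, so the search behind `Tr` succeeds.
  embedFp-Tr : ∀ x → embedFp (Tr x) ≡ τ x
  embedFp-Tr x with Fixed⇒Fp (subst Fixed (sym (trElt≡τ x)) (τ-Fixed x))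
  ... | k , eq = trans (cong embedFp (Tr≡findFp F x)) (trans (findFp-correct F (allFin p) (∈-allFin k) eq) (trElt≡τ x))

-- The Walsh spectrum of a quadratic function

𝟙 : {P : Set} → Dec P → ℤ
𝟙 (yes _) = ℤ.+ 1
𝟙 (no  _) = ℤ.+ 0

𝟙-true : ∀ {P : Set} (P? : Dec P) → P → 𝟙 P? ≡ ℤ.+ 1
𝟙-true (yes _) _ = refl
𝟙-true (no ¬P) P = contradiction P ¬P

𝟙-false : ∀ {P : Set} (P? : Dec P) → ¬ P → 𝟙 P? ≡ ℤ.+ 0
𝟙-false (yes P) ¬P = contradiction P ¬P
𝟙-false (no _)  _  = refl

𝟙-cong : ∀ {P Q : Set} (P? : Dec P) (Q? : Dec Q) → (P → Q) → (Q → P) → 𝟙 P? ≡ 𝟙 Q?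
𝟙-cong (yes P) Q? P⇒Q Q⇒P = sym (𝟙-true Q? (P⇒Q P))
𝟙-cong (no ¬P) Q? P⇒Q Q⇒P = sym (𝟙-false Q? (¬P ∘ Q⇒P))

𝟙-nonneg : ∀ {P : Set} (P? : Dec P) → ℤ.+ 0 ℤ.≤ 𝟙 P?
𝟙-nonneg (yes _) = ℤ.+≤+ z≤n
𝟙-nonneg (no _)  = ℤ.+≤+ z≤n

module Sumℤ {N : ℕ} {X : Set} (enum : Fin N ↔ X) where
  open Summation enum ℤₚ.+-0-commutativeMonoid public
  open import Algebra.Properties.Semiring.Sum ℤₚ.+-*-semiring using (sum; *-distribʳ-sum)

  ∑-*ʳ : ∀ (f : X → ℤ) c → ∑ (λ x → f x ℤ.* c) ≡ ∑ f ℤ.* c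
  ∑-*ʳ f c = sym (*-distribʳ-sum c (f ∘ Inverse.to enum))

  ∑-1 : ∑ (λ _ → ℤ.+ 1) ≡ ℤ.+ N
  ∑-1 = go N
    where
    go : ∀ m → sum {m} (λ _ → ℤ.+ 1) ≡ ℤ.+ m
    go zero    = refl
    go (suc m) = cong (λ s → ℤ.+ 1 ℤ.+ s) (go m)

  ∑-const : ∀ c → ∑ (λ _ → c) ≡ ℤ.+ N ℤ.* c
  ∑-const c = trans (∑-cong (λ _ → sym (ℤₚ.*-identityˡ c))) (trans (∑-*ʳ (λ _ → ℤ.+ 1) c) (cong (ℤ._* c) ∑-1))

  ∑-mono : ∀ {f g : X → ℤ} → (∀ x → f x ℤ.≤ g x) → ∑ f ℤ.≤ ∑ g
  ∑-mono f≤g = go (f≤g ∘ Inverse.to enum)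
    where
    go : ∀ {m} {s t : Fin m → ℤ} → (∀ i → s i ℤ.≤ t i) → sum s ℤ.≤ sum t
    go {zero}  s≤t = ℤₚ.≤-refl
    go {suc m} s≤t = ℤₚ.+-mono-≤ (s≤t Fin.zero) (go (s≤t ∘ Fin.suc))

module WalshTheory {p n : ℕ} .{{_ : NonZero p}} (pr : Prime p) (1≤n : 1 ℕ.≤ n) (F : FiniteField p n) where
  open TraceTheory pr 1≤n F public
  open ≡-Reasoning
  open Sumℤ enum public

  module Fp = Sumℤ (↔-id (Fin p))

  0Fp 1Fp : Fin p
  0Fp = 0 mod p
  1Fp = 1 mod p

  embedFp-neg : ∀ i → embedFp (negFp p i) ≡ - embedFp i
  embedFp-neg i = begin
    embedFp ((p ℕ.∸ toℕ i) mod p)  ≡⟨ ι-mod _ ⟩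
    ι (p ℕ.∸ toℕ i)                ≡⟨ ι-∸ (ℕₚ.<⇒≤ (FinP.toℕ<n i)) ⟩
    ι p - embedFp i                ≡⟨ cong (_- embedFp i) ι-p ⟩
    0# - embedFp i                 ≡⟨ +-identityˡ _ ⟩
    - embedFp i                    ∎

  embedFp-sub : ∀ i j → embedFp (subFp p i j) ≡ embedFp i - embedFp j
  embedFp-sub i j = trans (ι-mod _) (trans (ι-+ (toℕ i) _) (cong (embedFp i +_) (embedFp-neg j)))

  embedFp-Fixed : ∀ i → Fixed (embedFp i)
  embedFp-Fixed i = φ-ι 1 (toℕ i)

  1Fp≢0Fp : 1Fp ≢ 0Fp
  1Fp≢0Fp eq = 0≢1 (trans (sym (ι-mod 0)) (trans (cong embedFp (sym eq)) (trans (ι-mod 1) ι-1)))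

  ∑-indicator : ∀ x₀ → ∑ (λ x → 𝟙 (x ≟ x₀)) ≡ ℤ.+ 1
  ∑-indicator x₀ = trans (∑-point x₀ (λ x → 𝟙 (x ≟ x₀)) (λ x → 𝟙-false (x ≟ x₀))) (𝟙-true (x₀ ≟ x₀) refl)

  fixed? : ∀ x → Dec (Fixed x)
  fixed? x = φ 1 x ≟ x

  -- Each fixed element is `embedFp k` for exactly one `k`; count the pairs in the other order.
  count-Fixed : ∑ (λ x → 𝟙 (fixed? x)) ≡ ℤ.+ p
  count-Fixed = begin
    ∑ (λ x → 𝟙 (fixed? x))                              ≡⟨ ∑-cong (λ x → sym (preimages x)) ⟩
    ∑ (λ x → Fp.∑ (λ k → 𝟙 (x ≟ embedFp k)))
      ≡⟨ ∑-swap enum (↔-id (Fin p)) ℤₚ.+-0-commutativeMonoid (λ x k → 𝟙 (x ≟ embedFp k)) ⟩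
    Fp.∑ (λ k → ∑ (λ x → 𝟙 (x ≟ embedFp k)))           ≡⟨ Fp.∑-cong (λ k → ∑-indicator (embedFp k)) ⟩
    Fp.∑ (λ _ → ℤ.+ 1)                                  ≡⟨ Fp.∑-1 ⟩
    ℤ.+ p                                               ∎
    where
    preimages : ∀ x → Fp.∑ (λ k → 𝟙 (x ≟ embedFp k)) ≡ 𝟙 (fixed? x)
    preimages x with fixed? x
    ... | no ¬fix = trans (Fp.∑-cong (λ k → 𝟙-false (x ≟ embedFp k) λ eq → ¬fix (subst Fixed (sym eq) (embedFp-Fixed k))))
      (trans (Fp.∑-const (ℤ.+ 0)) (ℤₚ.*-zeroʳ (ℤ.+ p)))
    ... | yes fix with Fixed⇒Fp fix
    ...   | k₀ , refl = trans
      (Fp.∑-point k₀ (λ k → 𝟙 (embedFp k₀ ≟ embedFp k)) (λ k k≢ → 𝟙-false (embedFp k₀ ≟ embedFp k) (λ eq → k≢ (embedFp-injective (sym eq)))))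
      (𝟙-true (embedFp k₀ ≟ embedFp k₀) refl)

  -- The substitute for the vanishing of character sums. Translation by the `u₁` belonging to
  -- `d = a - b` preserves the weight and matches the solutions of `ψ u ≡ b` with those of
  -- `ψ u ≡ a`.
  equidistributed : ∀ (w : Carrier → ℤ) (ψ : Carrier → Carrier) →
    (∀ {d} → Fixed d → ∃ λ u₁ → (∀ u → w (u + u₁) ≡ w u) × (∀ u → ψ (u + u₁) ≡ ψ u + d)) →
    ∀ {a b} → Fixed a → Fixed b → ∑ (λ u → 𝟙 (ψ u ≟ a) ℤ.* w u) ≡ ∑ (λ u → 𝟙 (ψ u ≟ b) ℤ.* w u)
  equidistributed w ψ shifts {a} {b} fa fb with shifts (Fixed-+ fa (Fixed-neg fb))
  ... | u₁ , w-shift , ψ-shift = begin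
    ∑ (λ u → 𝟙 (ψ u ≟ a) ℤ.* w u)
      ≡⟨ ∑-reindex (λ u → 𝟙 (ψ u ≟ a) ℤ.* w u) (_+ u₁) (_- u₁)
           (λ x → solve 2 (λ x u → x :- u :+ u := x) refl x u₁)
           (λ x → solve 2 (λ x u → x :+ u :- u := x) refl x u₁) ⟩
    ∑ (λ u → 𝟙 (ψ (u + u₁) ≟ a) ℤ.* w (u + u₁))
      ≡⟨ ∑-cong (λ u → cong₂ ℤ._*_ (𝟙-cong (ψ (u + u₁) ≟ a) (ψ u ≟ b) (forth u) (back u)) (w-shift u)) ⟩
    ∑ (λ u → 𝟙 (ψ u ≟ b) ℤ.* w u) ∎
    where
    forth : ∀ u → ψ (u + u₁) ≡ a → ψ u ≡ b
    forth u eq = begin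
      ψ u                        ≡⟨ solve 3 (λ x a b → x := x :+ (a :- b) :- a :+ b) refl (ψ u) a b ⟩
      ψ u + (a - b) - a + b      ≡⟨ cong (λ z → z - a + b) (trans (sym (ψ-shift u)) eq) ⟩
      a - a + b                  ≡⟨ solve 2 (λ a b → a :- a :+ b := b) refl a b ⟩
      b                          ∎
    back : ∀ u → ψ u ≡ b → ψ (u + u₁) ≡ a
    back u eq = trans (ψ-shift u) (trans (cong (_+ (a - b)) eq) (solve 2 (λ a b → b :+ (a :- b) := a) refl a b))

  εpow≡𝟙 : ∀ k j → εpow p k j ≡ 𝟙 (j Fin.≟ k)
  εpow≡𝟙 k j with j Fin.≟ k
  ... | yes _ = refl
  ... | no  _ = refl

  intᶜ≡𝟙 : ∀ m j → intᶜ p m j ≡ 𝟙 (j Fin.≟ 0Fp) ℤ.* m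
  intᶜ≡𝟙 m j with j Fin.≟ 0Fp
  ... | yes _ = sym (ℤₚ.*-identityˡ m)
  ... | no  _ = sym (ℤₚ.*-zeroˡ m)

  foldr-pointwise : ∀ {A : Set} (G : A → Cyc p) xs k →
    foldr (_+ᶜ_ p) (zeroᶜ p) (map G xs) k ≡ foldr ℤ._+_ (ℤ.+ 0) (map (λ x → G x k) xs)
  foldr-pointwise G []       k = refl
  foldr-pointwise G (x ∷ xs) k = cong (λ s → G x k ℤ.+ s) (foldr-pointwise G xs k)

  -- An element of Z[ε_p] has many coefficient vectors, so integers must be told apart: coefficient
  -- 1, distinct from coefficient 0 as p > 1, determines the additive constant, and coefficient 0
  -- then determines the integer.
  intᶜ-unique : ∀ z a b → _≈ᶜ_ p z (intᶜ p a) → _≈ᶜ_ p z (intᶜ p b) → a ≡ b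
  intᶜ-unique z a b (c , eqa) (d , eqb) = begin
    a                                       ≡⟨ rearrange (z 0Fp) a ⟩
    z 0Fp ℤ.- (z 0Fp ℤ.- a)
      ≡⟨ cong (λ s → z 0Fp ℤ.- s) (trans (at0 a c eqa) (trans c≡d (sym (at0 b d eqb)))) ⟩
    z 0Fp ℤ.- (z 0Fp ℤ.- b)                 ≡⟨ rearrange (z 0Fp) b ⟨
    b                                       ∎
    where
    rearrange : ∀ u v → v ≡ u ℤ.- (u ℤ.- v)
    rearrange = S.solve 2 (λ u v → v S.:= u S.:- (u S.:- v)) refl
      where module S = +-*-Solver
    at0 : ∀ m c → (∀ k → z k ℤ.- intᶜ p m k ≡ c) → z 0Fp ℤ.- m ≡ c
    at0 m c eq = trans (cong (λ s → z 0Fp ℤ.- s) (sym (trans (intᶜ≡𝟙 m 0Fp)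
      (trans (cong (ℤ._* m) (𝟙-true (0Fp Fin.≟ 0Fp) refl)) (ℤₚ.*-identityˡ m))))) (eq 0Fp)
    at1 : ∀ m c → (∀ k → z k ℤ.- intᶜ p m k ≡ c) → z 1Fp ≡ c
    at1 m c eq = trans (sym (ℤₚ.+-identityʳ (z 1Fp))) (trans (cong (λ s → z 1Fp ℤ.- s) (sym (trans (intᶜ≡𝟙 m 1Fp)
      (trans (cong (ℤ._* m) (𝟙-false (1Fp Fin.≟ 0Fp) 1Fp≢0Fp)) (ℤₚ.*-zeroˡ m))))) (eq 1Fp))
    c≡d : c ≡ d
    c≡d = trans (sym (at1 a c eqa)) (at1 b d eqb)

  -- Coefficients of the squared absolute value of the Walsh transform

  module Walsh (Q : Carrier → Carrier) (b : Carrier) where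
    f : Carrier → Fin p
    f x = Tr (Q x)

    h : Carrier → Carrier
    h x = τ (Q x) - τ (b * x)

    e : Carrier → Fin p
    e x = subFp p (f x) (Tr (b * x))

    embedFp-e : ∀ x → embedFp (e x) ≡ h x
    embedFp-e x = trans (embedFp-sub (f x) (Tr (b * x))) (cong₂ _-_ (embedFp-Tr (Q x)) (embedFp-Tr (b * x)))

    walsh-count : ∀ k → walsh F f b k ≡ ∑ (λ x → 𝟙 (k Fin.≟ e x))
    walsh-count k = begin
      walsh F f b k
        ≡⟨ foldr-pointwise (λ i → εpow p (e (Inverse.to enum i))) (allFin q) k ⟩
      foldr ℤ._+_ (ℤ.+ 0) (map (λ i → εpow p (e (Inverse.to enum i)) k) (allFin q))
        ≡⟨ foldr-allFin (λ x → εpow p (e x) k) ⟩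
      ∑ (λ x → εpow p (e x) k)
        ≡⟨ ∑-cong (λ x → εpow≡𝟙 (e x) k) ⟩
      ∑ (λ x → 𝟙 (k Fin.≟ e x)) ∎

    -- The squared norm is the sum of ε^(h x - h y) over all pairs. In the convolution only the
    -- index `i = e x` survives for a given `x`, and the conjugate factor then counts the `y`.
    normSq-count : ∀ k → normSqᶜ p (walsh F f b) k ≡ ∑ (λ x → ∑ (λ y → 𝟙 (h x - h y ≟ embedFp k)))
    normSq-count k = begin
      normSqᶜ p (walsh F f b) k
        ≡⟨ Fp.foldr-allFin (λ i → walsh F f b i ℤ.* V i) ⟩
      Fp.∑ (λ i → walsh F f b i ℤ.* V i)
        ≡⟨ Fp.∑-cong (λ i → trans (cong (ℤ._* V i) (walsh-count i)) (sym (∑-*ʳ (λ x → 𝟙 (i Fin.≟ e x)) (V i)))) ⟩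
      Fp.∑ (λ i → ∑ (λ x → 𝟙 (i Fin.≟ e x) ℤ.* V i))
        ≡⟨ ∑-swap (↔-id (Fin p)) enum ℤₚ.+-0-commutativeMonoid (λ i x → 𝟙 (i Fin.≟ e x) ℤ.* V i) ⟩
      ∑ (λ x → Fp.∑ (λ i → 𝟙 (i Fin.≟ e x) ℤ.* V i))
        ≡⟨ ∑-cong pick ⟩
      ∑ (λ x → V (e x))
        ≡⟨ ∑-cong (λ x → trans (walsh-count (negFp p (subFp p k (e x))))
             (∑-cong (λ y → 𝟙-cong (negFp p (subFp p k (e x)) Fin.≟ e y) (h x - h y ≟ embedFp k) (to x y) (from x y)))) ⟩
      ∑ (λ x → ∑ (λ y → 𝟙 (h x - h y ≟ embedFp k))) ∎
      where
      V : Fin p → ℤ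
      V i = walsh F f b (negFp p (subFp p k i))
      pick : ∀ x → Fp.∑ (λ i → 𝟙 (i Fin.≟ e x) ℤ.* V i) ≡ V (e x)
      pick x = trans
        (Fp.∑-point (e x) (λ i → 𝟙 (i Fin.≟ e x) ℤ.* V i)
          (λ i i≢ → trans (cong (ℤ._* V i) (𝟙-false (i Fin.≟ e x) i≢)) (ℤₚ.*-zeroˡ (V i))))
        (trans (cong (ℤ._* V (e x)) (𝟙-true (e x Fin.≟ e x) refl)) (ℤₚ.*-identityˡ (V (e x))))
      lhs : ∀ x → embedFp (negFp p (subFp p k (e x))) ≡ h x - embedFp k
      lhs x = begin
        embedFp (negFp p (subFp p k (e x)))  ≡⟨ embedFp-neg (subFp p k (e x)) ⟩
        - embedFp (subFp p k (e x))          ≡⟨ cong -_ (embedFp-sub k (e x)) ⟩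
        - (embedFp k - embedFp (e x))        ≡⟨ cong (λ z → - (embedFp k - z)) (embedFp-e x) ⟩
        - (embedFp k - h x)                  ≡⟨ solve 2 (λ a b → :- (a :- b) := b :- a) refl _ _ ⟩
        h x - embedFp k                      ∎
      to : ∀ x y → negFp p (subFp p k (e x)) ≡ e y → h x - h y ≡ embedFp k
      to x y eq = begin
        h x - h y
          ≡⟨ cong (λ s → h x - s) (trans (sym (embedFp-e y)) (trans (cong embedFp (sym eq)) (lhs x))) ⟩
        h x - (h x - embedFp k)    ≡⟨ solve 2 (λ a b → a :- (a :- b) := b) refl _ _ ⟩
        embedFp k                  ∎
      from : ∀ x y → h x - h y ≡ embedFp k → negFp p (subFp p k (e x)) ≡ e y
      from x y eq = embedFp-injective (begin
        embedFp (negFp p (subFp p k (e x)))  ≡⟨ lhs x ⟩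
        h x - embedFp k                      ≡⟨ cong (λ s → h x - s) eq ⟨
        h x - (h x - h y)                    ≡⟨ solve 2 (λ a b → a :- (a :- b) := b) refl _ _ ⟩
        h y                                  ≡⟨ embedFp-e y ⟨
        embedFp (e y)                        ∎)

    -- Substituting `x = y + u` sorts the pairs by their difference, so that for fixed `u` the polar
    -- form leaves an affine function of `y`.
    normSq-differences : ∀ k → normSqᶜ p (walsh F f b) k ≡ ∑ (λ u → ∑ (λ y → 𝟙 (h (y + u) - h y ≟ embedFp k)))
    normSq-differences k = begin
      normSqᶜ p (walsh F f b) k
        ≡⟨ normSq-count k ⟩
      ∑ (λ x → ∑ (λ y → 𝟙 (h x - h y ≟ embedFp k)))
        ≡⟨ ∑-swap enum enum ℤₚ.+-0-commutativeMonoid (λ x y → 𝟙 (h x - h y ≟ embedFp k)) ⟩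
      ∑ (λ y → ∑ (λ x → 𝟙 (h x - h y ≟ embedFp k)))
        ≡⟨ ∑-cong (λ y → ∑-reindex (λ x → 𝟙 (h x - h y ≟ embedFp k)) (y +_) (λ x → x - y)
             (λ x → solve 2 (λ x y → y :+ (x :- y) := x) refl x y)
             (λ x → solve 2 (λ x y → y :+ x :- y := x) refl x y)) ⟩
      ∑ (λ y → ∑ (λ u → 𝟙 (h (y + u) - h y ≟ embedFp k)))
        ≡⟨ ∑-swap enum enum ℤₚ.+-0-commutativeMonoid (λ y u → 𝟙 (h (y + u) - h y ≟ embedFp k)) ⟩
      ∑ (λ u → ∑ (λ y → 𝟙 (h (y + u) - h y ≟ embedFp k))) ∎

  -- All that the spectrum depends on; only `τ ∘ Q` is constrained. With `null` as a separate field,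
  -- the oddness of `p` enters where the record is built.
  record Quadratic (Q L : Carrier → Carrier) : Set where
    field
      polar   : ∀ y u → τ (Q (y + u)) ≡ τ (Q y) + τ (Q u) + τ (L u * y)
      null    : ∀ {u} → L u ≡ 0# → τ (Q u) ≡ 0#
      L-+     : ∀ u v → L (u + v) ≡ L u + L v
      L-scale : ∀ {s} → Fixed s → ∀ u → L (s * u) ≡ s * L u

  module QuadraticTheory {Q L : Carrier → Carrier} (quadratic : Quadratic Q L) where
    open Quadratic quadratic

    κ : ℤ
    κ = ∑ (λ u → 𝟙 (L u ≟ 0#))

    module At (b : Carrier) where
      open Walsh Q b public

      h-difference : ∀ y u → h (y + u) - h y ≡ h u + τ (L u * y)
      h-difference y u = begin
        (τ (Q (y + u)) - τ (b * (y + u))) - h y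
          ≡⟨ cong₂ (λ s t → (s - t) - h y) (polar y u) (trans (cong τ (distribˡ b y u)) (τ-+ _ _)) ⟩
        (τ (Q y) + τ (Q u) + τ (L u * y) - (τ (b * y) + τ (b * u))) - (τ (Q y) - τ (b * y))
          ≡⟨ solve 5 (λ qy qu l by bu → (qy :+ qu :+ l :- (by :+ bu)) :- (qy :- by) := (qu :- bu) :+ l)
               refl _ _ _ _ _ ⟩
        h u + τ (L u * y) ∎

      -- The share of the difference `u` in the coefficient of ε^a.
      M : Carrier → Carrier → ℤ
      M u a = ∑ (λ y → 𝟙 (h u + τ (L u * y) ≟ a))

      normSq-M : ∀ k → normSqᶜ p (walsh F f b) k ≡ ∑ (λ u → M u (embedFp k))
      normSq-M k = trans (normSq-differences k)
        (∑-cong λ u → ∑-cong λ y → cong (λ z → 𝟙 (z ≟ embedFp k)) (h-difference y u))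

      -- For `L u ≢ 0#` the function `y ↦ τ (L u * y)` takes all values in F_p equally often,
      -- because the trace is not identically 0.
      M-const : ∀ u → L u ≢ 0# → ∀ {a c} → Fixed a → Fixed c → M u a ≡ M u c
      M-const u Lu≢0 {a} {c} fa fc = trans (unit a) (trans (equidistributed (λ _ → ℤ.+ 1) ψ shifts fa fc) (sym (unit c)))
        where
        ψ : Carrier → Carrier
        ψ y = h u + τ (L u * y)
        unit : ∀ a → M u a ≡ ∑ (λ y → 𝟙 (ψ y ≟ a) ℤ.* ℤ.+ 1)
        unit a = ∑-cong (λ y → sym (ℤₚ.*-identityʳ (𝟙 (ψ y ≟ a))))
        shifts : ∀ {d} → Fixed d → ∃ λ u₁ → (∀ y → ℤ.+ 1 ≡ ℤ.+ 1) × (∀ y → ψ (y + u₁) ≡ ψ y + d)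
        shifts {d} fd with τ-nonzero
        ... | v , τv≢0 with inverse (L u) Lu≢0 | inverse (τ v) τv≢0
        -- With `i` and `j` inverse to `L u` and `τ v`, this translation changes `τ (L u * y)` by
        -- `τ (d * j * v) = d * j * τ v = d`.
        ...   | i , Lui | j , τvj = i * (d * j * v) , (λ _ → refl) , λ y → begin
          h u + τ (L u * (y + i * (d * j * v)))
            ≡⟨ cong (λ z → h u + τ z) (solve 4 (λ l y i w → l :* (y :+ i :* w) := l :* y :+ (l :* i) :* w)
                 refl (L u) y i (d * j * v)) ⟩
          h u + τ (L u * y + (L u * i) * (d * j * v))
            ≡⟨ cong (h u +_) (τ-+ _ _) ⟩
          h u + (τ (L u * y) + τ ((L u * i) * (d * j * v)))
            ≡⟨ cong (λ z → h u + (τ (L u * y) + τ z)) (trans (cong (_* (d * j * v)) Lui) (*-identityˡ _)) ⟩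
          h u + (τ (L u * y) + τ (d * j * v))
            ≡⟨ cong (λ z → h u + (τ (L u * y) + z)) (τ-scale (Fixed-* fd (Fixed-inverse (τ-Fixed v) τv≢0 τvj)) v) ⟩
          h u + (τ (L u * y) + d * j * τ v)
            ≡⟨ solve 5 (λ a b d j t → a :+ (b :+ d :* j :* t) := a :+ b :+ d :* (t :* j)) refl _ _ d j (τ v) ⟩
          h u + τ (L u * y) + d * (τ v * j)
            ≡⟨ cong (h u + τ (L u * y) +_) (trans (cong (d *_) τvj) (*-identityʳ d)) ⟩
          ψ y + d ∎

      h-kernel : ∀ {u} → L u ≡ 0# → h u ≡ - τ (b * u)
      h-kernel Lu≡0 = trans (cong (_- _) (null Lu≡0)) (+-identityˡ _)

      kernelTerm : Carrier → Carrier → ℤ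
      kernelTerm a u = 𝟙 (- τ (b * u) ≟ a) ℤ.* (𝟙 (L u ≟ 0#) ℤ.* ℤ.+ q)

      -- The share of `u` outside the kernel. There `M u` is constant on F_p, so its value at `0#`
      -- stands for all coefficients, and `∑ D` becomes the constant that `_≈ᶜ_` disregards.
      D : Carrier → ℤ
      D u with L u ≟ 0#
      ... | yes _ = ℤ.+ 0
      ... | no  _ = M u 0#

      M-split : ∀ {a} → Fixed a → ∀ u → M u a ≡ kernelTerm a u ℤ.+ D u
      M-split {a} fa u with L u ≟ 0#
      ... | yes Lu≡0 = begin
        M u a
          ≡⟨ ∑-cong (λ y → cong (λ z → 𝟙 (z ≟ a)) (value y)) ⟩
        ∑ (λ _ → 𝟙 (- τ (b * u) ≟ a))                           ≡⟨ ∑-const (𝟙 (- τ (b * u) ≟ a)) ⟩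
        ℤ.+ q ℤ.* 𝟙 (- τ (b * u) ≟ a)
          ≡⟨ Z.solve 2 (λ s t → s Z.:* t Z.:= t Z.:* (Z.con (ℤ.+ 1) Z.:* s) Z.:+ Z.con (ℤ.+ 0))
               refl (ℤ.+ q) (𝟙 (- τ (b * u) ≟ a)) ⟩
        𝟙 (- τ (b * u) ≟ a) ℤ.* (ℤ.+ 1 ℤ.* ℤ.+ q) ℤ.+ ℤ.+ 0     ∎
        where
        module Z = +-*-Solver
        value : ∀ y → h u + τ (L u * y) ≡ - τ (b * u)
        value y = begin
          h u + τ (L u * y)    ≡⟨ cong (λ z → h u + τ (z * y)) Lu≡0 ⟩
          h u + τ (0# * y)     ≡⟨ cong (λ z → h u + τ z) (zeroˡ y) ⟩
          h u + τ 0#           ≡⟨ cong (h u +_) τ-0# ⟩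
          h u + 0#             ≡⟨ +-identityʳ _ ⟩
          h u                  ≡⟨ h-kernel Lu≡0 ⟩
          - τ (b * u)          ∎
      ... | no Lu≢0 = trans (M-const u Lu≢0 fa (φ-0# 1)) (Z.solve 2 (λ s t → t Z.:= s Z.:* Z.con (ℤ.+ 0) Z.:+ t)
           refl (𝟙 (- τ (b * u) ≟ a)) (M u 0#))
        where module Z = +-*-Solver

      normSq-kernel : ∀ k → normSqᶜ p (walsh F f b) k ≡ ∑ (kernelTerm (embedFp k)) ℤ.+ ∑ D
      normSq-kernel k = trans (normSq-M k) (trans (∑-cong (M-split (embedFp-Fixed k))) (∑-distrib (kernelTerm (embedFp k)) D))

      normSq-constant : ∀ (m : ℤ) → (∀ k → ∑ (kernelTerm (embedFp k)) ≡ intᶜ p m k) → _≈ᶜ_ p (normSqᶜ p (walsh F f b)) (intᶜ p m)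
      normSq-constant m eq = ∑ D , λ k → trans
        (cong (ℤ._- intᶜ p m k) (trans (normSq-kernel k) (cong (ℤ._+ ∑ D) (eq k))))
        (Z.solve 2 (λ s t → s Z.:+ t Z.:- s Z.:= t) refl (intᶜ p m k) (∑ D))
        where module Z = +-*-Solver

      -- Every kernel element contributes `q` to the coefficient of index 0 and nothing to the
      -- others.
      normSq-orthogonal : (∀ u → L u ≡ 0# → τ (b * u) ≡ 0#) → _≈ᶜ_ p (normSqᶜ p (walsh F f b)) (intᶜ p (κ ℤ.* ℤ.+ q))
      normSq-orthogonal orth = normSq-constant (κ ℤ.* ℤ.+ q) λ k → begin
        ∑ (kernelTerm (embedFp k))                                       ≡⟨ ∑-cong (term k) ⟩
        ∑ (λ u → 𝟙 (L u ≟ 0#) ℤ.* (ℤ.+ q ℤ.* 𝟙 (k Fin.≟ 0Fp)))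
          ≡⟨ ∑-*ʳ (λ u → 𝟙 (L u ≟ 0#)) (ℤ.+ q ℤ.* 𝟙 (k Fin.≟ 0Fp)) ⟩
        κ ℤ.* (ℤ.+ q ℤ.* 𝟙 (k Fin.≟ 0Fp))
          ≡⟨ Z.solve 3 (λ s t i → s Z.:* (t Z.:* i) Z.:= i Z.:* (s Z.:* t)) refl κ (ℤ.+ q) (𝟙 (k Fin.≟ 0Fp)) ⟩
        𝟙 (k Fin.≟ 0Fp) ℤ.* (κ ℤ.* ℤ.+ q)                                ≡⟨ intᶜ≡𝟙 (κ ℤ.* ℤ.+ q) k ⟨
        intᶜ p (κ ℤ.* ℤ.+ q) k                                           ∎
        where
        module Z = +-*-Solver
        zero-value : ∀ k → 𝟙 (- 0# ≟ embedFp k) ≡ 𝟙 (k Fin.≟ 0Fp)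
        zero-value k = 𝟙-cong (- 0# ≟ embedFp k) (k Fin.≟ 0Fp)
          (λ eq → embedFp-injective (trans (sym eq) (trans -0#≈0# (sym (ι-mod 0)))))
          (λ eq → trans -0#≈0# (trans (sym (ι-mod 0)) (cong embedFp (sym eq))))
        term : ∀ k u → kernelTerm (embedFp k) u ≡ 𝟙 (L u ≟ 0#) ℤ.* (ℤ.+ q ℤ.* 𝟙 (k Fin.≟ 0Fp))
        term k u with L u ≟ 0#
        ... | no _     = Z.solve 3 (λ s t i → s Z.:* (Z.con (ℤ.+ 0) Z.:* t) Z.:= Z.con (ℤ.+ 0) Z.:* (t Z.:* i))
             refl (𝟙 (- τ (b * u) ≟ embedFp k)) (ℤ.+ q) (𝟙 (k Fin.≟ 0Fp))
        ... | yes Lu≡0 = trans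
          (cong (ℤ._* (ℤ.+ 1 ℤ.* ℤ.+ q)) (trans (cong (λ z → 𝟙 (- z ≟ embedFp k)) (orth u Lu≡0)) (zero-value k)))
          (Z.solve 2 (λ t i → i Z.:* (Z.con (ℤ.+ 1) Z.:* t) Z.:= Z.con (ℤ.+ 1) Z.:* (t Z.:* i))
               refl (ℤ.+ q) (𝟙 (k Fin.≟ 0Fp)))

      -- On the kernel `u ↦ - τ (b * u)` is a non-zero F_p-linear form, so it is equidistributed
      -- there. All coefficients then agree, which means 0 in Z[ε_p].
      normSq-nonorthogonal : ∀ {u₀} → L u₀ ≡ 0# → τ (b * u₀) ≢ 0# → _≈ᶜ_ p (normSqᶜ p (walsh F f b)) (intᶜ p (ℤ.+ 0))
      normSq-nonorthogonal {u₀} Lu₀≡0 τ≢0 = ∑ (kernelTerm 0#) ℤ.+ ∑ D , λ k → begin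
        normSqᶜ p (walsh F f b) k ℤ.- intᶜ p (ℤ.+ 0) k
          ≡⟨ cong (λ s → normSqᶜ p (walsh F f b) k ℤ.- s) (trans (intᶜ≡𝟙 (ℤ.+ 0) k) (ℤₚ.*-zeroʳ (𝟙 (k Fin.≟ 0Fp)))) ⟩
        normSqᶜ p (walsh F f b) k ℤ.- ℤ.+ 0              ≡⟨ ℤₚ.+-identityʳ (normSqᶜ p (walsh F f b) k) ⟩
        normSqᶜ p (walsh F f b) k                        ≡⟨ normSq-kernel k ⟩
        ∑ (kernelTerm (embedFp k)) ℤ.+ ∑ D
          ≡⟨ cong (ℤ._+ ∑ D) (equidistributed w ψ shifts (embedFp-Fixed k) (φ-0# 1)) ⟩
        ∑ (kernelTerm 0#) ℤ.+ ∑ D                        ∎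
        where
        w : Carrier → ℤ
        w u = 𝟙 (L u ≟ 0#) ℤ.* ℤ.+ q
        ψ : Carrier → Carrier
        ψ u = - τ (b * u)
        shifts : ∀ {d} → Fixed d → ∃ λ u₁ → (∀ u → w (u + u₁) ≡ w u) × (∀ u → ψ (u + u₁) ≡ ψ u + d)
        shifts {d} fd with inverse (τ (b * u₀)) τ≢0
        ... | j , τj = s * u₀ , w-shift , ψ-shift
          where
          -- Multiples of `u₀` by elements of F_p stay in the kernel; the factor -d / τ(b u₀) raises
          -- `ψ` by `d`, its sign compensating the one in `ψ`.
          s : Carrier
          s = - (d * j)
          fs : Fixed s
          fs = Fixed-neg (Fixed-* fd (Fixed-inverse (τ-Fixed _) τ≢0 τj))
          L-shift : ∀ u → L (u + s * u₀) ≡ L u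
          L-shift u = begin
            L (u + s * u₀)       ≡⟨ L-+ u (s * u₀) ⟩
            L u + L (s * u₀)     ≡⟨ cong (L u +_) (L-scale fs u₀) ⟩
            L u + s * L u₀       ≡⟨ cong (λ z → L u + s * z) Lu₀≡0 ⟩
            L u + s * 0#         ≡⟨ cong (L u +_) (zeroʳ s) ⟩
            L u + 0#             ≡⟨ +-identityʳ _ ⟩
            L u                  ∎
          w-shift : ∀ u → w (u + s * u₀) ≡ w u
          w-shift u = cong (λ z → 𝟙 (z ≟ 0#) ℤ.* ℤ.+ q) (L-shift u)
          ψ-shift : ∀ u → ψ (u + s * u₀) ≡ ψ u + d
          ψ-shift u = begin
            - τ (b * (u + s * u₀))
              ≡⟨ cong (λ z → - τ z) (solve 4 (λ b u s v → b :* (u :+ s :* v) := b :* u :+ s :* (b :* v))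
                   refl b u s u₀) ⟩
            - τ (b * u + s * (b * u₀))         ≡⟨ cong -_ (trans (τ-+ _ _) (cong (τ (b * u) +_) (τ-scale fs _))) ⟩
            - (τ (b * u) + s * τ (b * u₀))
              ≡⟨ solve 4 (λ a d j t → :- (a :+ (:- (d :* j)) :* t) := (:- a) :+ d :* (t :* j)) refl _ d j _ ⟩
            - τ (b * u) + d * (τ (b * u₀) * j) ≡⟨ cong (- τ (b * u) +_) (trans (cong (d *_) τj) (*-identityʳ d)) ⟩
            - τ (b * u) + d                    ∎

    L-0# : L 0# ≡ 0#
    L-0# = trans (cong L (sym (zeroˡ 0#))) (trans (L-scale (φ-0# 1) 0#) (zeroˡ _))

    -- `0#` lies in the kernel. This excludes the value 0 of the squared norm at `b = 0#`.
    κ≢0 : κ ≢ ℤ.+ 0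
    κ≢0 κ≡0 with subst (ℤ.+ 1 ℤ.≤_) κ≡0 (subst (ℤ._≤ κ) (∑-indicator 0#) (∑-mono below))
      where
      below : ∀ x → 𝟙 (x ≟ 0#) ℤ.≤ 𝟙 (L x ≟ 0#)
      below x with x ≟ 0#
      ... | yes refl = ℤₚ.≤-reflexive (sym (𝟙-true (L 0# ≟ 0#) L-0#))
      ... | no _     = 𝟙-nonneg (L x ≟ 0#)
    ... | ℤ.+≤+ ()

    -- Necessity is read off at `b = 0#`, which is orthogonal to the kernel: the squared norm there
    -- is `κ * q`, not 0, and so has to be `p * q`.
    nearBent⇔ : NearBent F (λ x → Tr (Q x)) ⇔ κ ≡ ℤ.+ p
    nearBent⇔ = mk⇔ forward backward
      where
      instance
        q≢0 : NonZero q
        q≢0 = ℕₚ.m^n≢0 p n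
      p*q : ℤ.+ (p ^ suc n) ≡ ℤ.+ p ℤ.* ℤ.+ q
      p*q = ℤₚ.pos-* p q
      N : Carrier → Cyc p
      N b = normSqᶜ p (walsh F (λ x → Tr (Q x)) b)
      at-0# : _≈ᶜ_ p (N 0#) (intᶜ p (κ ℤ.* ℤ.+ q))
      at-0# = At.normSq-orthogonal 0# (λ u _ → trans (cong τ (zeroˡ u)) τ-0#)
      forward : NearBent F (λ x → Tr (Q x)) → κ ≡ ℤ.+ p
      forward nb = [ (λ ≈0 → contradiction
                       (ℤₚ.*-cancelʳ-≡ κ (ℤ.+ 0) (ℤ.+ q)
                         (trans (intᶜ-unique (N 0#) (κ ℤ.* ℤ.+ q) (ℤ.+ 0) at-0# ≈0) (sym (ℤₚ.*-zeroˡ (ℤ.+ q))))) κ≢0)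
                   , (λ ≈pq → ℤₚ.*-cancelʳ-≡ κ (ℤ.+ p) (ℤ.+ q)
                       (trans (intᶜ-unique (N 0#) (κ ℤ.* ℤ.+ q) (ℤ.+ (p ^ suc n)) at-0# ≈pq) p*q))
                   ]′ (nb 0#)
      backward : κ ≡ ℤ.+ p → NearBent F (λ x → Tr (Q x))
      backward κ≡p b = [ (λ (u₀ , Lu₀≡0 , τ≢0) → inj₁ (At.normSq-nonorthogonal b Lu₀≡0 τ≢0))
                       , (λ none → inj₂ (subst (λ m → _≈ᶜ_ p (N b) (intᶜ p m))
                           (trans (cong (ℤ._* ℤ.+ q) κ≡p) (sym p*q))
                           (At.normSq-orthogonal b (λ u Lu≡0 → decidable-stable (τ (b * u) ≟ 0#) (λ τ≢0 → none u (Lu≡0 , τ≢0))))))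
                       ]′ (search (λ u → (L u ≟ 0#) ×-dec ¬? (τ (b * u) ≟ 0#)))

-- Kernels of the Frobenius polynomials (σ^a + ε)(σ^b + ε)

parity : ∀ m → (∃ λ k → m ≡ k ℕ.* 2) ⊎ (∃ λ k → m ≡ suc (k ℕ.* 2))
parity zero = inj₁ (0 , refl)
parity (suc m) with parity m
... | inj₁ (k , refl) = inj₂ (k , refl)
... | inj₂ (k , refl) = inj₁ (suc k , refl)

odd%2 : ∀ k → suc (k ℕ.* 2) % 2 ≡ 1
odd%2 k = [m+kn]%n≡m%n 1 k 2

even%2 : ∀ k → k ℕ.* 2 % 2 ≡ 0
even%2 k = [m+kn]%n≡m%n 0 k 2

-- It serves to show that the two exponents in the factorization have the same parity, which leaves
-- the cases both even and both odd.
r+t≡∣r-t∣+even : ∀ r t → ∃ λ k → r ℕ.+ t ≡ ∣ r - t ∣ ℕ.+ k ℕ.* 2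
r+t≡∣r-t∣+even zero    t       = 0 , sym (ℕₚ.+-identityʳ t)
r+t≡∣r-t∣+even (suc r) zero    = 0 , refl
r+t≡∣r-t∣+even (suc r) (suc t) with r+t≡∣r-t∣+even r t
... | k , eq = suc k , (begin
  suc (r ℕ.+ suc t)                    ≡⟨ cong suc (ℕₚ.+-suc r t) ⟩
  suc (suc (r ℕ.+ t))                  ≡⟨ cong (suc ∘ suc) eq ⟩
  suc (suc (∣ r - t ∣ ℕ.+ k ℕ.* 2))    ≡⟨ cong suc (ℕₚ.+-suc ∣ r - t ∣ (k ℕ.* 2)) ⟨
  suc (∣ r - t ∣ ℕ.+ suc (k ℕ.* 2))    ≡⟨ ℕₚ.+-suc ∣ r - t ∣ (suc (k ℕ.* 2)) ⟨
  ∣ r - t ∣ ℕ.+ suc k ℕ.* 2            ∎)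
  where open ≡-Reasoning

odd≢even : ∀ {a} k m → a ≡ suc (k ℕ.* 2) → a ≢ m ℕ.* 2
odd≢even k m odd even = contradiction (trans (sym (odd%2 k)) (trans (cong (_% 2) (trans (sym odd) even)) (even%2 m))) λ ()

∣2⇒≡1⊎≡2 : ∀ d → d ∣ 2 → d ≡ 1 ⊎ d ≡ 2
∣2⇒≡1⊎≡2 zero                (divides m 2≡) = contradiction (trans 2≡ (ℕₚ.*-zeroʳ m)) λ ()
∣2⇒≡1⊎≡2 (suc zero)          _              = inj₁ refl
∣2⇒≡1⊎≡2 (suc (suc zero))    _              = inj₂ refl
∣2⇒≡1⊎≡2 (suc (suc (suc d))) d∣2            = contradiction (∣⇒≤ d∣2) λ { (s≤s (s≤s ())) }

-- `gcd n a` divides 2 and the odd number `a`.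
gcd-odd : ∀ n a k → a ≡ suc (k ℕ.* 2) → gcd n (2 ℕ.* a) ≡ 2 → gcd n a ≡ 1
gcd-odd n a k a≡ eq = [ id , (λ ≡2 → contradiction (subst (_∣ a) ≡2 (gcd[m,n]∣n n a)) λ (divides m even) → odd≢even k m a≡ even) ]′
  (∣2⇒≡1⊎≡2 (gcd n a) (subst (gcd n a ∣_) eq (gcd-greatest (gcd[m,n]∣m n a) (∣-trans (gcd[m,n]∣n n a) (n∣m*n 2)))))

-- The factor 2 is taken out of both arguments, and `gcd m a` divides `gcd n a`. The parity in the
-- name is that of `n`.
gcd-even : ∀ n m a → n ≡ m ℕ.* 2 → gcd n a ≡ 1 → gcd n (2 ℕ.* a) ≡ 2
gcd-even n m a n≡ eq = begin
  gcd n (2 ℕ.* a)            ≡⟨ cong (λ k → gcd k (2 ℕ.* a)) n≡2m ⟩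
  gcd (2 ℕ.* m) (2 ℕ.* a)    ≡⟨ c*gcd[m,n]≡gcd[cm,cn] 2 m a ⟨
  2 ℕ.* gcd m a
    ≡⟨ cong (2 ℕ.*_) (∣1⇒≡1 (subst (gcd m a ∣_) eq (gcd-greatest (∣-trans (gcd[m,n]∣m m a) (divides 2 n≡2m)) (gcd[m,n]∣n m a)))) ⟩
  2                          ∎
  where
  open ≡-Reasoning
  n≡2m : n ≡ 2 ℕ.* m
  n≡2m = trans n≡ (ℕₚ.*-comm m 2)

module KernelTheory {p n : ℕ} .{{_ : NonZero p}} (pr : Prime p) (p-odd : p % 2 ≡ 1) (1≤n : 1 ℕ.≤ n) (F : FiniteField p n) where
  open WalshTheory pr 1≤n F public
  open ≡-Reasoning

  2≢0 : 1# + 1# ≢ 0#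
  2≢0 eq = odd p pr p-odd (∣⇒≤ (ι≡0⇒p∣ {2} (trans (cong (1# +_) (+-identityʳ 1#)) eq)))
    where
    odd : ∀ p → Prime p → p % 2 ≡ 1 → ¬ p ℕ.≤ 2
    odd (suc zero)    pr _ _ = ℕₚ.<-irrefl refl (prime>1 pr)
    odd (suc (suc zero)) _ () _
    odd (suc (suc (suc _))) _ _ (s≤s (s≤s ()))

  x≡-x⇒x≡0 : ∀ {x} → x ≡ - x → x ≡ 0#
  x≡-x⇒x≡0 {x} eq = *-zero-factor (1# + 1#) 2≢0 (begin
    (1# + 1#) * x  ≡⟨ solve 1 (λ x → (con (ℤ.+ 1) :+ con (ℤ.+ 1)) :* x := x :+ x) refl x ⟩
    x + x          ≡⟨ cong (x +_) eq ⟩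
    x - x          ≡⟨ -‿inverseʳ x ⟩
    0#             ∎)

  -- A Bézout identity between natural numbers makes an iterate of one map equal to σ followed by an
  -- iterate of the other; both iterates fix `x`.
  φ-coprime : ∀ a b x → gcd a b ≡ 1 → φ a x ≡ x → φ b x ≡ x → Fixed x
  φ-coprime a b x gcd≡1 fa fb with coprime-Bézout (gcd≡1⇒coprime {a} {b} gcd≡1)
  ... | Bézout.+- s t eq = begin
    φ 1 x                 ≡⟨ cong (φ 1) (φ-fixed-* b t x fb) ⟨
    φ 1 (φ (t ℕ.* b) x)   ≡⟨ φ-∘ 1 (t ℕ.* b) x ⟩
    φ (1 ℕ.+ t ℕ.* b) x   ≡⟨ cong (λ k → φ k x) eq ⟩
    φ (s ℕ.* a) x         ≡⟨ φ-fixed-* a s x fa ⟩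
    x                     ∎
  ... | Bézout.-+ s t eq = begin
    φ 1 x                 ≡⟨ cong (φ 1) (φ-fixed-* a s x fa) ⟨
    φ 1 (φ (s ℕ.* a) x)   ≡⟨ φ-∘ 1 (s ℕ.* a) x ⟩
    φ (1 ℕ.+ s ℕ.* a) x   ≡⟨ cong (λ k → φ k x) eq ⟩
    φ (t ℕ.* b) x         ≡⟨ φ-fixed-* b t x fb ⟩
    x                     ∎

  -- The trace to the fixed field of φ d takes values outside the fixed field
  -- of φ 1: otherwise φ 1 ∘ T - T, monic of degree p^(n-d+1), would vanish.
  subfield-proper : ∀ {d} → d ∣ n → 1 ℕ.< d → ∃ λ y → φ d y ≡ y × ¬ Fixed y
  subfield-proper (divides zero n≡0) _ = contradiction (subst (1 ℕ.≤_) n≡0 1≤n) λ ()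
  subfield-proper {d} (divides (suc j) n≡) 1<d with φ-nonroot N<n lower
    where
    g : ℕ → Carrier → Carrier
    g i = φ (i ℕ.* d)
    N : ℕ
    N = suc (j ℕ.* d)
    N<n : N ℕ.< n
    N<n = subst (N ℕ.<_) (sym n≡) (ℕₚ.+-monoˡ-< (j ℕ.* d) 1<d)
    i*d≤j*d : ∀ {i} → i ℕ.< j → i ℕ.* d ℕ.< j ℕ.* d
    i*d≤j*d i<j = ℕₚ.*-monoˡ-< d {{ℕ.>-nonZero (ℕₚ.<-trans (s≤s z≤n) 1<d)}} i<j
    lower : Poly< (p ^ N) (λ x → S (λ i → φ (suc (i ℕ.* d)) x) j - S (λ i → g i x) (suc j))
    lower = Poly<-+ (p ^ N)
      (Poly<-S (p ^ N) (λ i → φ (suc (i ℕ.* d))) j (λ i<j → Poly<-φ (s≤s (i*d≤j*d i<j))))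
      (Poly<-neg (p ^ N) (Poly<-S (p ^ N) g (suc j) (λ i<1+j → Poly<-φ (s≤s (ℕₚ.*-monoˡ-≤ d (ℕₚ.≤-pred i<1+j))))))
  ... | x , nonroot = T , T-fixed , T-not-fixed
    where
    g : ℕ → Carrier
    g i = φ (i ℕ.* d) x
    T : Carrier
    T = S g (suc j)
    T-fixed : φ d T ≡ T
    T-fixed = begin
      φ d T                        ≡⟨ S-φ d g (suc j) ⟩
      S (λ i → φ d (g i)) (suc j)  ≡⟨ S-cong (λ i → φ-∘ d (i ℕ.* d) x) (suc j) ⟩
      S (g ∘ suc) (suc j)
        ≡⟨ S-cyclic g (suc j) (trans (cong (λ k → φ k x) (sym n≡)) (trans (φ-n x) (sym (φ-0 x)))) ⟩
      T                            ∎
    T-not-fixed : ¬ Fixed T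
    T-not-fixed fix = nonroot (begin
      φ (suc (j ℕ.* d)) x + (S h j - T)    ≡⟨ solve 3 (λ a b c → a :+ (b :- c) := (b :+ a) :- c) refl _ _ _ ⟩
      S h (suc j) - T
        ≡⟨ x≡y⇒x-y≡0 (trans (trans (S-cong (λ i → sym (φ-∘ 1 (i ℕ.* d) x)) (suc j)) (sym (S-φ 1 g (suc j)))) fix) ⟩
      0#                                   ∎)
      where
      h : ℕ → Carrier
      h i = φ (suc (i ℕ.* d)) x

  -- Two exponents matter: `k = n` gives `n e = 0`, and a factor exponent shows that σ^k - 1 sends
  -- `x` into F_p.
  φ-translate : ∀ {x e} → φ 1 x ≡ x + e → Fixed e → ∀ k → φ k x ≡ x + ι k * e
  φ-translate {x} {e} eq fe zero    = trans (φ-0 x) (solve 2 (λ x e → x := x :+ con (ℤ.+ 0) :* e) refl x e)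
  φ-translate {x} {e} eq fe (suc k) = begin
    φ (suc k) x              ≡⟨ φ-∘ 1 k x ⟨
    φ 1 (φ k x)              ≡⟨ cong (φ 1) (φ-translate eq fe k) ⟩
    φ 1 (x + ι k * e)        ≡⟨ φ-+ 1 x (ι k * e) ⟩
    φ 1 x + φ 1 (ι k * e)    ≡⟨ cong₂ _+_ eq (Fixed-* (φ-ι 1 k) fe) ⟩
    x + e + ι k * e
      ≡⟨ solve 3 (λ x e k → x :+ e :+ k :* e := x :+ (con (ℤ.+ 1) :+ k) :* e) refl x e (ι k) ⟩
    x + ι (suc k) * e        ∎

  -- Additive Hilbert 90 for a constant: x = Σ i φ^i(θ) with τ θ ≠ 0.
  translate-exists : p ∣ n → ∃ λ x → ∃ λ e → Fixed e × e ≢ 0# × φ 1 x ≡ x + e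
  translate-exists p∣n with τ-nonzero
  ... | θ , τθ≢0 = x , - τ θ , Fixed-neg (τ-Fixed θ) , (λ eq → τθ≢0 (trans (sym (-‿involutive _)) (trans (cong -_ eq) -0#≈0#))) , (begin
    φ 1 x                        ≡⟨ solve 2 (λ a t → a := a :+ t :- t) refl (φ 1 x) (τ θ) ⟩
    φ 1 x + τ θ - τ θ            ≡⟨ cong (_- τ θ) φx+τ ⟩
    x - τ θ                      ∎)
    where
    g : ℕ → Carrier
    g i = ι i * φ i θ
    x : Carrier
    x = S g n
    φx+τ : φ 1 x + τ θ ≡ x
    φx+τ = begin
      φ 1 x + τ θ                                   ≡⟨ cong₂ _+_ (S-φ 1 g n) (sym (τ-φ1 θ)) ⟩
      S (λ i → φ 1 (g i)) n + S (λ i → φ i (φ 1 θ)) n ≡⟨ S-+ (λ i → φ 1 (g i)) (λ i → φ i (φ 1 θ)) n ⟨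
      S (λ i → φ 1 (g i) + φ i (φ 1 θ)) n           ≡⟨ S-cong step n ⟩
      S (g ∘ suc) n
        ≡⟨ S-cyclic g n (trans (cong (_* φ n θ) (ι-multiple p∣n)) (trans (zeroˡ _) (sym (zeroˡ _)))) ⟩
      x                                             ∎
      where
      step : ∀ i → φ 1 (g i) + φ i (φ 1 θ) ≡ g (suc i)
      step i = begin
        φ 1 (ι i * φ i θ) + φ i (φ 1 θ)       ≡⟨ cong₂ _+_ (φ-* 1 (ι i) (φ i θ)) (φ-comm i 1 θ) ⟩
        φ 1 (ι i) * φ 1 (φ i θ) + φ 1 (φ i θ) ≡⟨ cong₂ (λ a b → a * b + b) (φ-ι 1 i) (φ-∘ 1 i θ) ⟩
        ι i * φ (suc i) θ + φ (suc i) θ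
          ≡⟨ solve 2 (λ a b → a :* b :+ b := (con (ℤ.+ 1) :+ a) :* b) refl (ι i) _ ⟩
        g (suc i)                             ∎

  -- The line F_p w has exactly `p` elements, and membership in it is `Fixed (x * i)`, with `i` the
  -- inverse of `w`. As `P` contains the line, a point of `P` off the line would force at least
  -- `p + 1` elements.
  count-line : ∀ {P : Carrier → Set} (P? : ∀ x → Dec (P x)) {w i} → w * i ≡ 1# →
    (∀ {s} → Fixed s → P (s * w)) → ∑ (λ x → 𝟙 (P? x)) ≡ ℤ.+ p ⇔ (∀ x → P x → Fixed (x * i))
  count-line {P} P? {w} {i} wi≡1 line = mk⇔ forward backward
    where
    undo : ∀ x → x * i * w ≡ x
    undo x = trans (solve 3 (λ x i w → x :* i :* w := x :* (w :* i))
         refl x i w) (trans (cong (x *_) wi≡1) (*-identityʳ x))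
    redo : ∀ x → x * w * i ≡ x
    redo x = trans (*-assoc x w i) (trans (cong (x *_) wi≡1) (*-identityʳ x))
    count-scaled : ∑ (λ x → 𝟙 (fixed? (x * i))) ≡ ℤ.+ p
    count-scaled = trans (sym (∑-reindex (λ x → 𝟙 (fixed? x)) (_* i) (_* w) redo undo)) count-Fixed
    onLine : ∀ {x} → Fixed (x * i) → P x
    onLine {x} fix = subst P (undo x) (line fix)
    forward : ∑ (λ x → 𝟙 (P? x)) ≡ ℤ.+ p → ∀ x → P x → Fixed (x * i)
    forward count x₀ Px₀ with fixed? (x₀ * i)
    ... | yes fix = fix
    ... | no ¬fix = contradiction
      (subst (ℤ.+ p ℤ.+ ℤ.+ 1 ℤ.≤_) count
        (subst (ℤ._≤ ∑ (λ x → 𝟙 (P? x)))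
          (trans (∑-distrib (λ x → 𝟙 (fixed? (x * i))) (λ x → 𝟙 (x ≟ x₀))) (cong₂ ℤ._+_ count-scaled (∑-indicator x₀)))
          (∑-mono below)))
      (λ p+1≤p → ℕₚ.<-irrefl refl (subst (ℕ._≤ p) (ℕₚ.+-comm p 1) (ℤₚ.drop‿+≤+ p+1≤p)))
      where
      below : ∀ x → 𝟙 (fixed? (x * i)) ℤ.+ 𝟙 (x ≟ x₀) ℤ.≤ 𝟙 (P? x)
      below x with fixed? (x * i) | x ≟ x₀
      ... | yes fix | yes refl = contradiction fix ¬fix
      ... | yes fix | no _     = ℤₚ.≤-reflexive (sym (𝟙-true (P? x) (onLine fix)))
      ... | no _    | yes refl = ℤₚ.≤-reflexive (sym (𝟙-true (P? x) Px₀))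
      ... | no _    | no _     = 𝟙-nonneg (P? x)
    backward : (∀ x → P x → Fixed (x * i)) → ∑ (λ x → 𝟙 (P? x)) ≡ ℤ.+ p
    backward inside = trans (∑-cong (λ x → 𝟙-cong (P? x) (fixed? (x * i)) (inside x) onLine)) count-scaled

  -- The operators σ^k + ε and the kernels of their products

  Δ : Carrier → ℕ → Carrier → Carrier
  Δ ε k x = φ k x + ε * x

  Δ-comm : ∀ {ε} → Fixed ε → ∀ a b x → Δ ε a (Δ ε b x) ≡ Δ ε b (Δ ε a x)
  Δ-comm {ε} fε a b x = begin
    φ a (φ b x + ε * x) + ε * (φ b x + ε * x)          ≡⟨ cong (_+ ε * (φ b x + ε * x)) (expand a b) ⟩
    φ (a ℕ.+ b) x + ε * φ a x + ε * (φ b x + ε * x)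
      ≡⟨ cong (λ k → φ k x + ε * φ a x + ε * (φ b x + ε * x)) (ℕₚ.+-comm a b) ⟩
    φ (b ℕ.+ a) x + ε * φ a x + ε * (φ b x + ε * x)
      ≡⟨ solve 5 (λ y ε u v x → y :+ ε :* u :+ ε :* (v :+ ε :* x) := y :+ ε :* v :+ ε :* (u :+ ε :* x))
           refl _ ε _ _ x ⟩
    φ (b ℕ.+ a) x + ε * φ b x + ε * (φ a x + ε * x)    ≡⟨ cong (_+ ε * (φ a x + ε * x)) (expand b a) ⟨
    φ b (φ a x + ε * x) + ε * (φ a x + ε * x)          ∎
    where
    expand : ∀ a b → φ a (φ b x + ε * x) ≡ φ (a ℕ.+ b) x + ε * φ a x
    expand a b = trans (φ-+ a _ _) (cong₂ _+_ (φ-∘ a b x) (trans (φ-* a ε x) (cong (_* φ a x) (φ-Fixed fε a))))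

  Δ-0# : ∀ ε k → Δ ε k 0# ≡ 0#
  Δ-0# ε k = trans (cong₂ _+_ (φ-0# k) (zeroʳ ε)) (+-identityˡ 0#)

  Kernel : Carrier → ℕ → ℕ → Carrier → Set
  Kernel ε a b x = Δ ε a (Δ ε b x) ≡ 0#

  kernel? : ∀ ε a b x → Dec (Kernel ε a b x)
  kernel? ε a b x = Δ ε a (Δ ε b x) ≟ 0#

  count : Carrier → ℕ → ℕ → ℤ
  count ε a b = ∑ (λ x → 𝟙 (kernel? ε a b x))

  Δ-neg : ∀ ε k x → Δ ε k (- x) ≡ - Δ ε k x
  Δ-neg ε k x = trans (cong (_+ ε * (- x)) (φ-neg k x)) (solve 3 (λ u ε x → (:- u) :+ ε :* (:- x) := :- (u :+ ε :* x))
       refl _ ε x)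

  Kernel-line : ∀ ε a b {w} → Kernel ε a b w → ∀ {s} → Fixed s → Kernel ε a b (s * w)
  Kernel-line ε a b {w} ker {s} fs = trans (cong (Δ ε a) (Δ-scale b w))
    (trans (Δ-scale a _) (trans (cong (s *_) ker) (zeroʳ s)))
    where
    Δ-scale : ∀ k x → Δ ε k (s * x) ≡ s * Δ ε k x
    Δ-scale k x = trans (cong (_+ ε * (s * x)) (trans (φ-* k s x) (cong (_* φ k x) (φ-Fixed fs k))))
      (solve 4 (λ s ε x u → s :* u :+ ε :* (s :* x) := s :* (u :+ ε :* x)) refl s ε x _)

  Fixed-1 : Fixed 1#
  Fixed-1 = φ-1# 1

  Fixed-neg1 : Fixed (- 1#)
  Fixed-neg1 = Fixed-neg Fixed-1

  Δ⁻≡0⇒fixed : ∀ k x → Δ (- 1#) k x ≡ 0# → φ k x ≡ x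
  Δ⁻≡0⇒fixed k x eq = x-y≡0⇒x≡y (φ k x) x (trans (solve 2 (λ u x → u :- x := u :+ (:- con (ℤ.+ 1)) :* x)
       refl _ x) eq)

  fixed⇒Δ⁻≡0 : ∀ k x → φ k x ≡ x → Δ (- 1#) k x ≡ 0#
  fixed⇒Δ⁻≡0 k x eq = trans (solve 2 (λ u x → u :+ (:- con (ℤ.+ 1)) :* x := u :- x) refl _ x) (x≡y⇒x-y≡0 eq)

  Δ⁺≡0⇒negated : ∀ k x → Δ 1# k x ≡ 0# → φ k x ≡ - x
  Δ⁺≡0⇒negated k x eq = x-y≡0⇒x≡y (φ k x) (- x) (trans (solve 2 (λ u x → u :- (:- x) := u :+ con (ℤ.+ 1) :* x)
       refl _ x) eq)

  fixed-a⇒Kernel : ∀ a b {x} → φ a x ≡ x → Kernel (- 1#) a b x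
  fixed-a⇒Kernel a b {x} eq = trans (Δ-comm Fixed-neg1 a b x) (trans (cong (Δ (- 1#) b) (fixed⇒Δ⁻≡0 a x eq)) (Δ-0# (- 1#) b))

  fixed-b⇒Kernel : ∀ a b {x} → φ b x ≡ x → Kernel (- 1#) a b x
  fixed-b⇒Kernel a b {x} eq = trans (cong (Δ (- 1#) a) (fixed⇒Δ⁻≡0 b x eq)) (Δ-0# (- 1#) a)

  fixed-multiple : ∀ {d a} → d ∣ a → ∀ {x} → φ d x ≡ x → φ a x ≡ x
  fixed-multiple (divides k refl) {x} eq = φ-fixed-* _ k x eq

  gcd≡1-if : ∀ a → (∀ x → φ a x ≡ x → Fixed x) → gcd n a ≡ 1
  gcd≡1-if a all-fixed = go (gcd n a) refl
    where
    go : ∀ d → gcd n a ≡ d → gcd n a ≡ 1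
    go zero             eq = contradiction (subst (1 ℕ.≤_) (gcd[m,n]≡0⇒m≡0 eq) 1≤n) λ ()
    go (suc zero)       eq = eq
    go (suc (suc d))    eq with subfield-proper (subst (_∣ n) eq (gcd[m,n]∣m n a)) (s≤s (s≤s z≤n))
    ... | y , φy , ¬fix = contradiction (all-fixed y (fixed-multiple (subst (_∣ a) eq (gcd[m,n]∣n n a)) φy)) ¬fix

  gcd[n,p]≡1-if : ¬ p ∣ n → gcd n p ≡ 1
  gcd[n,p]≡1-if p∤n with prime⇒irreducible pr (gcd[m,n]∣n n p)
  ... | inj₁ ≡1 = ≡1
  ... | inj₂ ≡p = contradiction (subst (_∣ n) ≡p (gcd[m,n]∣m n p)) p∤n

  Kernel⁻⊆Fixed⇔ : ∀ a b → (∀ x → Kernel (- 1#) a b x → Fixed x) ⇔ (gcd n a ≡ 1 × gcd n b ≡ 1 × gcd n p ≡ 1)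
  Kernel⁻⊆Fixed⇔ a b = mk⇔ forward backward
    where
    forward : (∀ x → Kernel (- 1#) a b x → Fixed x) → gcd n a ≡ 1 × gcd n b ≡ 1 × gcd n p ≡ 1
    forward all-fixed = gcd≡1-if a (λ x → all-fixed x ∘ fixed-a⇒Kernel a b)
                      , gcd≡1-if b (λ x → all-fixed x ∘ fixed-b⇒Kernel a b)
                      , gcd[n,p]≡1-if p∤n
      where
      p∤n : ¬ p ∣ n
      p∤n p∣n with translate-exists p∣n
      -- σ moves `x`, yet σ^b - 1 sends it to `b e` in F_p, which σ^a - 1 annihilates; so `x` would
      -- be a kernel element outside F_p.
      ... | x , e , fe , e≢0 , φx = e≢0 (+-cancelˡ-0 x e (trans (sym (all-fixed x in-kernel)) φx))
        where
        Δb : Δ (- 1#) b x ≡ ι b * e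
        Δb = trans (cong (_+ - 1# * x) (φ-translate φx fe b))
          (solve 2 (λ x y → x :+ y :+ (:- con (ℤ.+ 1)) :* x := y) refl x (ι b * e))
        in-kernel : Kernel (- 1#) a b x
        in-kernel = fixed⇒Δ⁻≡0 a _ (subst (λ y → φ a y ≡ y) (sym Δb) (φ-Fixed (Fixed-* (φ-ι 1 b) fe) a))
    backward : gcd n a ≡ 1 × gcd n b ≡ 1 × gcd n p ≡ 1 → ∀ x → Kernel (- 1#) a b x → Fixed x
    -- For `x` in the kernel, σ^b x - x is fixed by σ^a and by σ^n, hence lies in F_p. As σ^b - 1
    -- commutes with σ - 1, the element `z = σ x - x` is fixed by σ^b and lies in F_p as well.
    -- Therefore `x = σ^n x = x + n z`, and `n` is not 0 modulo `p`.
    backward (gcd-a , gcd-b , gcd-p) x ker = trans φx (trans (cong (x +_) z≡0) (+-identityʳ x))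
      where
      z : Carrier
      z = Δ (- 1#) 1 x
      Δb-Fixed : Fixed (Δ (- 1#) b x)
      Δb-Fixed = φ-coprime n a _ gcd-a (φ-n _) (Δ⁻≡0⇒fixed a _ ker)
      z-Fixed : Fixed z
      z-Fixed = φ-coprime n b z gcd-b (φ-n z)
        (Δ⁻≡0⇒fixed b z (trans (Δ-comm Fixed-neg1 b 1 x) (fixed⇒Δ⁻≡0 1 _ Δb-Fixed)))
      φx : φ 1 x ≡ x + z
      φx = solve 2 (λ u x → u := x :+ (u :+ (:- con (ℤ.+ 1)) :* x)) refl (φ 1 x) x
      ιn≢0 : ι n ≢ 0#
      ιn≢0 eq = ℕₚ.<-irrefl (sym (∣1⇒≡1 (subst (p ∣_) gcd-p (gcd-greatest (ι≡0⇒p∣ {n} eq) (divides 1 (sym (ℕₚ.*-identityˡ p))))))) 1<p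
      z≡0 : z ≡ 0#
      z≡0 = *-zero-factor (ι n) ιn≢0 (+-cancelˡ-0 x (ι n * z) (trans (sym (φ-n x)) (φ-translate φx z-Fixed n)))

  -- The kernel contains F_p, the line through `1#`, so `count-line` applies with `w = 1#`.
  count⁻⇔ : ∀ a b → count (- 1#) a b ≡ ℤ.+ p ⇔ (gcd n a ≡ 1 × gcd n b ≡ 1 × gcd n p ≡ 1)
  count⁻⇔ a b = mk⇔
    (λ eq → Equivalence.to (Kernel⁻⊆Fixed⇔ a b) (λ x ker → subst Fixed (*-identityʳ x) (Equivalence.to line⇔ eq x ker)))
    (λ cond → Equivalence.from line⇔ (λ x ker → subst Fixed (sym (*-identityʳ x)) (Equivalence.from (Kernel⁻⊆Fixed⇔ a b) cond x ker)))
    where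
    line⇔ : count (- 1#) a b ≡ ℤ.+ p ⇔ (∀ x → Kernel (- 1#) a b x → Fixed (x * 1#))
    line⇔ = count-line (kernel? (- 1#) a b) (*-identityˡ 1#)
      (λ {s} fs → subst (Kernel (- 1#) a b) (sym (*-identityʳ s)) (fixed-b⇒Kernel a b (φ-Fixed fs b)))

  -- Kernels for the plus sign

  1≢p : ℤ.+ 1 ≢ ℤ.+ p
  1≢p eq = ℕₚ.<-irrefl (ℤₚ.+-injective eq) 1<p

  trivial-kernel : ∀ ε a b → (∀ x → Kernel ε a b x → x ≡ 0#) → count ε a b ≢ ℤ.+ p
  trivial-kernel ε a b trivial eq = 1≢p (begin
    ℤ.+ 1                 ≡⟨ ∑-indicator 0# ⟨
    ∑ (λ x → 𝟙 (x ≟ 0#))  ≡⟨ ∑-cong (λ x → 𝟙-cong (x ≟ 0#) (kernel? ε a b x) (λ { refl → 0∈ }) (trivial x)) ⟩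
    count ε a b           ≡⟨ eq ⟩
    ℤ.+ p                 ∎)
    where
    0∈ : Kernel ε a b 0#
    0∈ = trans (cong (Δ ε a) (Δ-0# ε b)) (Δ-0# ε a)

  negated-even : ∀ k {x} → φ k x ≡ - x → ∀ m → φ (m ℕ.* 2 ℕ.* k) x ≡ x
  negated-even k {x} eq m = subst (λ j → φ j x ≡ x) (sym (ℕₚ.*-assoc m 2 k)) (φ-fixed-* (2 ℕ.* k) m x twice)
    where
    twice : φ (2 ℕ.* k) x ≡ x
    twice = begin
      φ (k ℕ.+ (k ℕ.+ 0)) x  ≡⟨ φ-∘ k (k ℕ.+ 0) x ⟨
      φ k (φ (k ℕ.+ 0) x)    ≡⟨ cong (λ j → φ k (φ j x)) (ℕₚ.+-identityʳ k) ⟩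
      φ k (φ k x)            ≡⟨ cong (φ k) eq ⟩
      φ k (- x)              ≡⟨ φ-neg k x ⟩
      - φ k x                ≡⟨ cong -_ eq ⟩
      - - x                  ≡⟨ -‿involutive x ⟩
      x                      ∎

  negated-odd : ∀ k {x} → φ k x ≡ - x → ∀ m → φ (suc (m ℕ.* 2) ℕ.* k) x ≡ - x
  negated-odd k {x} eq m = trans (sym (φ-∘ k (m ℕ.* 2 ℕ.* k) x)) (trans (cong (φ k) (negated-even k eq m)) eq)

  -- Evaluate σ^(a n) x in two ways: it is `x` because σ^n is the identity, and `- x` because σ^a
  -- negates `x` and is applied an odd number of times.
  n-odd⇒Δ⁺-injective : ∀ m → n ≡ suc (m ℕ.* 2) → ∀ a x → Δ 1# a x ≡ 0# → x ≡ 0#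
  n-odd⇒Δ⁺-injective m n≡ a x eq = x≡-x⇒x≡0 (begin
    x                             ≡⟨ φ-n* a x ⟨
    φ (a ℕ.* n) x                 ≡⟨ cong (λ k → φ k x) (trans (ℕₚ.*-comm a n) (cong (ℕ._* a) n≡)) ⟩
    φ (suc (m ℕ.* 2) ℕ.* a) x     ≡⟨ negated-odd a (Δ⁺≡0⇒negated a x eq) m ⟩
    - x                           ∎)

  n-odd⇒count⁺≢p : ∀ m → n ≡ suc (m ℕ.* 2) → ∀ a b → count 1# a b ≢ ℤ.+ p
  n-odd⇒count⁺≢p m n≡ a b = trivial-kernel 1# a b (λ x ker → n-odd⇒Δ⁺-injective m n≡ b x (n-odd⇒Δ⁺-injective m n≡ a _ ker))

  -- If `y` is fixed by σ^2 but not by σ, then σ exchanges the two terms of `φ 1 y - y`.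
  negated-exists : 2 ∣ n → ∃ λ z → z ≢ 0# × φ 1 z ≡ - z
  negated-exists 2∣n with subfield-proper 2∣n (s≤s (s≤s z≤n))
  ... | y , φ2y , ¬fix = φ 1 y - y , (λ eq → ¬fix (x-y≡0⇒x≡y _ _ eq)) , (begin
    φ 1 (φ 1 y - y)         ≡⟨ φ-sub 1 (φ 1 y) y ⟩
    φ 1 (φ 1 y) - φ 1 y     ≡⟨ cong (_- φ 1 y) (trans (φ-∘ 1 1 y) φ2y) ⟩
    y - φ 1 y               ≡⟨ solve 2 (λ y u → y :- u := :- (u :- y)) refl y (φ 1 y) ⟩
    - (φ 1 y - y)           ∎)

  module _ {z : Carrier} (z≢0 : z ≢ 0#) (φz : φ 1 z ≡ - z) where
    φ-even-z : ∀ k → φ (k ℕ.* 2) z ≡ z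
    φ-even-z k = subst (λ j → φ j z ≡ z) (ℕₚ.*-identityʳ (k ℕ.* 2)) (negated-even 1 φz k)

    φ-odd-z : ∀ k → φ (suc (k ℕ.* 2)) z ≡ - z
    φ-odd-z k = subst (λ j → φ j z ≡ - z) (ℕₚ.*-identityʳ (suc (k ℕ.* 2))) (negated-odd 1 φz k)

    Δ⁺-even : ∀ k x → Δ 1# (k ℕ.* 2) (z * x) ≡ z * Δ 1# (k ℕ.* 2) x
    Δ⁺-even k x = trans (cong (_+ 1# * (z * x)) (trans (φ-* (k ℕ.* 2) z x) (cong (_* φ (k ℕ.* 2) x) (φ-even-z k))))
      (solve 3 (λ z x u → z :* u :+ con (ℤ.+ 1) :* (z :* x) := z :* (u :+ con (ℤ.+ 1) :* x)) refl z x _)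

    -- An odd power of σ negates `z`, so pulling `z` out turns σ^k + 1 into -(σ^k - 1).
    Δ⁺-odd : ∀ k x → Δ 1# (suc (k ℕ.* 2)) (z * x) ≡ z * (- Δ (- 1#) (suc (k ℕ.* 2)) x)
    Δ⁺-odd k x = trans (cong (_+ 1# * (z * x)) (trans (φ-* (suc (k ℕ.* 2)) z x) (cong (_* φ (suc (k ℕ.* 2)) x) (φ-odd-z k))))
      (solve 3 (λ z x u → (:- z) :* u :+ con (ℤ.+ 1) :* (z :* x) := z :* (:- (u :+ (:- con (ℤ.+ 1)) :* x)))
           refl z x _)

    ¬Fixed-z : ¬ Fixed z
    ¬Fixed-z fix = z≢0 (x≡-x⇒x≡0 (trans (sym fix) φz))

    -- The kernel is then closed under multiplication by z, which is not in 𝔽_p.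
    even⇒count⁺≢p : ∀ j k → count 1# (j ℕ.* 2) (k ℕ.* 2) ≢ ℤ.+ p
    even⇒count⁺≢p j k eq with search (λ x → kernel? 1# (j ℕ.* 2) (k ℕ.* 2) x ×-dec ¬? (x ≟ 0#))
    ... | inj₂ none = trivial-kernel 1# (j ℕ.* 2) (k ℕ.* 2) (λ x ker → decidable-stable (x ≟ 0#) (λ x≢0 → none x (ker , x≢0))) eq
    ... | inj₁ (w , ker , w≢0) with inverse w w≢0
    ...   | i , wi≡1 = ¬Fixed-z (subst Fixed zwi≡z
              (Equivalence.to (count-line (kernel? 1# (j ℕ.* 2) (k ℕ.* 2)) wi≡1 (Kernel-line 1# (j ℕ.* 2) (k ℕ.* 2) ker))
                eq (z * w) zw∈))
      where
      zwi≡z : z * w * i ≡ z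
      zwi≡z = trans (*-assoc z w i) (trans (cong (z *_) wi≡1) (*-identityʳ z))
      zw∈ : Kernel 1# (j ℕ.* 2) (k ℕ.* 2) (z * w)
      zw∈ = trans (cong (Δ 1# (j ℕ.* 2)) (Δ⁺-even k w)) (trans (Δ⁺-even j _) (trans (cong (z *_) ker) (zeroʳ z)))

    -- Each of the two factors changes its type and yields one minus sign; the signs cancel in
    -- `twisted`.
    odd⇒count⁺≡count⁻ : ∀ j k → count 1# (suc (j ℕ.* 2)) (suc (k ℕ.* 2)) ≡ count (- 1#) (suc (j ℕ.* 2)) (suc (k ℕ.* 2))
    odd⇒count⁺≡count⁻ j k with inverse z z≢0
    ... | i , zi≡1 = trans
      (∑-reindex (λ x → 𝟙 (kernel? 1# a b x)) (z *_) (i *_)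
        (λ x → trans (sym (*-assoc z i x)) (trans (cong (_* x) zi≡1) (*-identityˡ x)))
        (λ x → trans (sym (*-assoc i z x)) (trans (cong (_* x) (trans (*-comm i z) zi≡1)) (*-identityˡ x))))
      (∑-cong (λ x → 𝟙-cong (kernel? 1# a b (z * x)) (kernel? (- 1#) a b x)
        (λ ker → *-zero-factor z z≢0 (trans (sym (twisted x)) ker))
        (λ ker → trans (twisted x) (trans (cong (z *_) ker) (zeroʳ z)))))
      where
      a b : ℕ
      a = suc (j ℕ.* 2)
      b = suc (k ℕ.* 2)
      twisted : ∀ x → Δ 1# a (Δ 1# b (z * x)) ≡ z * Δ (- 1#) a (Δ (- 1#) b x)
      twisted x = begin
        Δ 1# a (Δ 1# b (z * x))                    ≡⟨ cong (Δ 1# a) (Δ⁺-odd k x) ⟩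
        Δ 1# a (z * (- Δ (- 1#) b x))              ≡⟨ Δ⁺-odd j _ ⟩
        z * (- Δ (- 1#) a (- Δ (- 1#) b x))        ≡⟨ cong (λ y → z * (- y)) (Δ-neg (- 1#) a _) ⟩
        z * (- - Δ (- 1#) a (Δ (- 1#) b x))        ≡⟨ cong (z *_) (-‿involutive _) ⟩
        z * Δ (- 1#) a (Δ (- 1#) b x)              ∎

  count⁺-even : ∀ a b j k → a ≡ j ℕ.* 2 → b ≡ k ℕ.* 2 → count 1# a b ≢ ℤ.+ p
  count⁺-even _ _ j k refl refl eq =
    [ (λ (m , n≡) → let z , z≢0 , φz = negated-exists (divides m n≡) in even⇒count⁺≢p z≢0 φz j k eq)
    , (λ (m , n≡) → n-odd⇒count⁺≢p m n≡ (j ℕ.* 2) (k ℕ.* 2) eq)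
    ]′ (parity n)

  count⁺-odd : ∀ a b j k → a ≡ suc (j ℕ.* 2) → b ≡ suc (k ℕ.* 2) → 2 ∣ n → count 1# a b ≡ count (- 1#) a b
  count⁺-odd _ _ j k refl refl 2∣n = let z , z≢0 , φz = negated-exists 2∣n in odd⇒count⁺≡count⁻ z≢0 φz j k

  Condition⁺ : ℕ → ℕ → Set
  Condition⁺ a b = gcd n (2 ℕ.* a) ≡ 2 × gcd n (2 ℕ.* b) ≡ 2 × b % 2 ≡ 1 × gcd n p ≡ 1

  -- For even `n` and odd `a` the equations `gcd n (2 * a) ≡ 2` and `gcd n a ≡ 1` agree. The former
  -- also forces `n` to be even, without which the kernel is trivial.
  count⁺-odd⇔ : ∀ a b j k → a ≡ suc (j ℕ.* 2) → b ≡ suc (k ℕ.* 2) → count 1# a b ≡ ℤ.+ p ⇔ Condition⁺ a b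
  count⁺-odd⇔ a b j k a≡ b≡ = mk⇔ forward backward
    where
    double : ∀ m → n ≡ m ℕ.* 2 → gcd n a ≡ 1 × gcd n b ≡ 1 × gcd n p ≡ 1 → Condition⁺ a b
    double m n≡ (gcd-a , gcd-b , gcd-p) =
      gcd-even n m a n≡ gcd-a , gcd-even n m b n≡ gcd-b , trans (cong (_% 2) b≡) (odd%2 k) , gcd-p
    forward : count 1# a b ≡ ℤ.+ p → Condition⁺ a b
    forward eq =
      [ (λ (m , n≡) → double m n≡
          (Equivalence.to (count⁻⇔ a b) (trans (sym (count⁺-odd a b j k a≡ b≡ (divides m n≡))) eq)))
      , (λ (m , n≡) → contradiction eq (n-odd⇒count⁺≢p m n≡ a b))
      ]′ (parity n)
    backward : Condition⁺ a b → count 1# a b ≡ ℤ.+ p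
    backward (gcd-2a , gcd-2b , _ , gcd-p) = trans
      (count⁺-odd a b j k a≡ b≡ (subst (_∣ n) gcd-2a (gcd[m,n]∣m n (2 ℕ.* a))))
      (Equivalence.from (count⁻⇔ a b) (gcd-odd n a j a≡ gcd-2a , gcd-odd n b k b≡ gcd-2b , gcd-p))

  -- The equation says that `a` and `b` have the same parity. If both are even, both sides fail: the
  -- count by `count⁺-even`, the condition by its clause on `b % 2`.
  count⁺⇔ : ∀ a b l → a ≡ b ℕ.+ l ℕ.* 2 → count 1# a b ≡ ℤ.+ p ⇔ Condition⁺ a b
  count⁺⇔ a b l a≡ =
    [ (λ (k , b≡) → mk⇔
        (λ eq → contradiction eq (count⁺-even a b (k ℕ.+ l) k (trans a≡ (trans (cong (ℕ._+ l ℕ.* 2) b≡) (sym (ℕₚ.*-distribʳ-+ 2 k l)))) b≡))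
        (λ (_ , _ , b%2≡1 , _) → contradiction (trans (sym (even%2 k)) (trans (cong (_% 2) (sym b≡)) b%2≡1)) λ ()))
    , (λ (k , b≡) → count⁺-odd⇔ a b (k ℕ.+ l) k (trans a≡ (trans (cong (ℕ._+ l ℕ.* 2) b≡) (cong suc (sym (ℕₚ.*-distribʳ-+ 2 k l))))) b≡)
    ]′ (parity b)

-- The quadratic functions c x^(p^r+1) + ε c x^(p^t+1)

module GoldTheory {p n : ℕ} .{{_ : NonZero p}} (pr : Prime p) (p-odd : p % 2 ≡ 1) (1≤n : 1 ≤ n) (F : FiniteField p n)
  (c : FiniteField.Carrier F) where
  open KernelTheory pr p-odd 1≤n F public
  open ≡-Reasoning

  gold : ℕ → Carrier → Carrier
  gold r x = c * pow x (p ^ r ℕ.+ 1)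

  -- This is σ^(-r): the exponent (n-1)r is congruent to -r modulo `n`, and σ^n is the identity.
  φ⁻ : ℕ → Carrier → Carrier
  φ⁻ r = φ (ℕ.pred n ℕ.* r)

  φφ⁻ : ∀ r x → φ r (φ⁻ r x) ≡ x
  φφ⁻ r x = trans (φ-∘ r (ℕ.pred n ℕ.* r) x) (trans (cong (λ k → φ k x) r+≡) (φ-n* r x))
    where
    r+≡ : r ℕ.+ ℕ.pred n ℕ.* r ≡ r ℕ.* n
    r+≡ = trans (cong (ℕ._* r) (ℕₚ.suc-pred n {{ℕ.>-nonZero 1≤n}})) (ℕₚ.*-comm n r)

  A : ℕ → Carrier → Carrier
  A r u = φ r u + φ⁻ r u

  A-+ : ∀ r u v → A r (u + v) ≡ A r u + A r v
  A-+ r u v = trans (cong₂ _+_ (φ-+ r u v) (φ-+ (ℕ.pred n ℕ.* r) u v))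
    (solve 4 (λ a b c d → a :+ b :+ (c :+ d) := a :+ c :+ (b :+ d)) refl _ _ _ _)

  A-scale : ∀ r {s} → Fixed s → ∀ u → A r (s * u) ≡ s * A r u
  A-scale r {s} fs u = trans (cong₂ _+_ (scale r) (scale (ℕ.pred n ℕ.* r))) (sym (distribˡ s _ _))
    where
    scale : ∀ k → φ k (s * u) ≡ s * φ k u
    scale k = trans (φ-* k s u) (cong (_* φ k u) (φ-Fixed fs k))

  gold≡ : ∀ r x → gold r x ≡ c * (φ r x * x)
  gold≡ r x = cong (c *_) (trans (pow-+ x (p ^ r) 1) (cong (φ r x *_) (pow-1 x)))

  module _ (fc : Fixed c) where

    -- For the trace form the adjoint of σ^r is σ^(-r), because the trace is invariant under σ^r;
    -- the coefficient `c` passes through since it lies in F_p.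
    τ-adjoint : ∀ r u y → τ (c * (φ r y * u)) ≡ τ (c * (φ⁻ r u * y))
    τ-adjoint r u y = begin
      τ (c * (φ r y * u))
        ≡⟨ cong τ (cong₂ (λ s t → s * (φ r y * t)) (sym (φ-Fixed fc r)) (sym (φφ⁻ r u))) ⟩
      τ (φ r c * (φ r y * φ r (φ⁻ r u)))       ≡⟨ cong (λ s → τ (φ r c * s)) (φ-* r y (φ⁻ r u)) ⟨
      τ (φ r c * φ r (y * φ⁻ r u))             ≡⟨ cong τ (φ-* r c (y * φ⁻ r u)) ⟨
      τ (φ r (c * (y * φ⁻ r u)))               ≡⟨ τ-φ r (c * (y * φ⁻ r u)) ⟩
      τ (c * (y * φ⁻ r u))                     ≡⟨ cong (λ s → τ (c * s)) (*-comm y (φ⁻ r u)) ⟩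
      τ (c * (φ⁻ r u * y))                     ∎

    τ-A : ∀ r u y → τ (c * A r u * y) ≡ τ (c * (φ r u * y)) + τ (c * (φ r y * u))
    τ-A r u y = begin
      τ (c * A r u * y)
        ≡⟨ cong τ (solve 4 (λ c u v y → c :* (u :+ v) :* y := c :* (u :* y) :+ c :* (v :* y))
             refl c (φ r u) (φ⁻ r u) y) ⟩
      τ (c * (φ r u * y) + c * (φ⁻ r u * y))         ≡⟨ τ-+ (c * (φ r u * y)) (c * (φ⁻ r u * y)) ⟩
      τ (c * (φ r u * y)) + τ (c * (φ⁻ r u * y))     ≡⟨ cong (τ (c * (φ r u * y)) +_) (τ-adjoint r u y) ⟨
      τ (c * (φ r u * y)) + τ (c * (φ r y * u))      ∎

    gold-polar : ∀ r y u → τ (gold r (y + u)) ≡ τ (gold r y) + τ (gold r u) + τ (c * A r u * y)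
    gold-polar r y u = begin
      τ (gold r (y + u))
        ≡⟨ cong τ (trans (gold≡ r (y + u)) (cong (λ s → c * (s * (y + u))) (φ-+ r y u))) ⟩
      τ (c * ((φ r y + φ r u) * (y + u)))
        ≡⟨ cong τ (solve 5 (λ c a b y u → c :* ((a :+ b) :* (y :+ u)) := c :* (a :* y) :+ c :* (b :* u) :+ (c :* (b :* y) :+ c :* (a :* u)))
             refl c (φ r y) (φ r u) y u) ⟩
      τ (c * (φ r y * y) + c * (φ r u * u) + (c * (φ r u * y) + c * (φ r y * u)))
        ≡⟨ trans (τ-+ _ _) (cong₂ _+_ (τ-+ _ _) (τ-+ _ _)) ⟩
      τ (c * (φ r y * y)) + τ (c * (φ r u * u)) + (τ (c * (φ r u * y)) + τ (c * (φ r y * u)))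
        ≡⟨ cong₂ _+_ (cong₂ _+_ (cong τ (sym (gold≡ r y))) (cong τ (sym (gold≡ r u)))) (sym (τ-A r u y)) ⟩
      τ (gold r y) + τ (gold r u) + τ (c * A r u * y) ∎

    -- On the diagonal the polar form is twice the quadratic form. With 2 invertible, this makes the
    -- form vanish on the kernel of `L`.
    gold-diagonal : ∀ r u → τ (c * A r u * u) ≡ (1# + 1#) * τ (gold r u)
    gold-diagonal r u = begin
      τ (c * A r u * u)                               ≡⟨ τ-A r u u ⟩
      τ (c * (φ r u * u)) + τ (c * (φ r u * u))       ≡⟨ cong (λ s → τ s + τ s) (gold≡ r u) ⟨
      τ (gold r u) + τ (gold r u)
        ≡⟨ solve 1 (λ x → x :+ x := (con (ℤ.+ 1) :+ con (ℤ.+ 1)) :* x) refl (τ (gold r u)) ⟩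
      (1# + 1#) * τ (gold r u)                        ∎

    module _ {ε : Carrier} (fε : Fixed ε) (r t : ℕ) where
      L : Carrier → Carrier
      L u = c * (A r u + ε * A t u)

      goldPair : Carrier → Carrier
      goldPair x = gold r x + ε * gold t x

      τ-goldPair : ∀ x → τ (goldPair x) ≡ τ (gold r x) + ε * τ (gold t x)
      τ-goldPair x = trans (τ-+ (gold r x) (ε * gold t x)) (cong (τ (gold r x) +_) (τ-scale fε (gold t x)))

      τ-L : ∀ u y → τ (L u * y) ≡ τ (c * A r u * y) + ε * τ (c * A t u * y)
      τ-L u y = begin
        τ (L u * y)
          ≡⟨ cong τ (solve 5 (λ c a e b y → c :* (a :+ e :* b) :* y := c :* a :* y :+ e :* (c :* b :* y))
               refl c (A r u) ε (A t u) y) ⟩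
        τ (c * A r u * y + ε * (c * A t u * y))       ≡⟨ τ-+ (c * A r u * y) (ε * (c * A t u * y)) ⟩
        τ (c * A r u * y) + τ (ε * (c * A t u * y))   ≡⟨ cong (τ (c * A r u * y) +_) (τ-scale fε (c * A t u * y)) ⟩
        τ (c * A r u * y) + ε * τ (c * A t u * y)     ∎

      -- `Q` is only pointwise equal to `goldPair`, so that a difference can be treated with the
      -- factor `ε = - 1#` without rewriting inside `NearBent`.
      quadratic : ∀ {Q} → (∀ x → Q x ≡ goldPair x) → Quadratic Q L
      quadratic {Q} Q≡ = record { polar = polar ; null = null ; L-+ = L-+ ; L-scale = L-scale }
        where
        τQ : ∀ x → τ (Q x) ≡ τ (gold r x) + ε * τ (gold t x)
        τQ x = trans (cong τ (Q≡ x)) (τ-goldPair x)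
        polar : ∀ y u → τ (Q (y + u)) ≡ τ (Q y) + τ (Q u) + τ (L u * y)
        polar y u = begin
          τ (Q (y + u))
            ≡⟨ τQ (y + u) ⟩
          τ (gold r (y + u)) + ε * τ (gold t (y + u))
            ≡⟨ cong₂ (λ s t → s + ε * t) (gold-polar r y u) (gold-polar t y u) ⟩
          τ (gold r y) + τ (gold r u) + τ (c * A r u * y) + ε * (τ (gold t y) + τ (gold t u) + τ (c * A t u * y))
            ≡⟨ solve 7 (λ e a b c a′ b′ c′ → a :+ b :+ c :+ e :* (a′ :+ b′ :+ c′) := (a :+ e :* a′) :+ (b :+ e :* b′) :+ (c :+ e :* c′))
                 refl ε _ _ _ _ _ _ ⟩
          (τ (gold r y) + ε * τ (gold t y)) + (τ (gold r u) + ε * τ (gold t u)) + (τ (c * A r u * y) + ε * τ (c * A t u * y))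
            ≡⟨ cong₂ _+_ (cong₂ _+_ (τQ y) (τQ u)) (τ-L u y) ⟨
          τ (Q y) + τ (Q u) + τ (L u * y) ∎
        null : ∀ {u} → L u ≡ 0# → τ (Q u) ≡ 0#
        null {u} Lu≡0 = *-zero-factor (1# + 1#) 2≢0 (begin
          (1# + 1#) * τ (Q u)
            ≡⟨ cong ((1# + 1#) *_) (τQ u) ⟩
          (1# + 1#) * (τ (gold r u) + ε * τ (gold t u))
            ≡⟨ solve 3 (λ e a b → (con (ℤ.+ 1) :+ con (ℤ.+ 1)) :* (a :+ e :* b) := (con (ℤ.+ 1) :+ con (ℤ.+ 1)) :* a :+ e :* ((con (ℤ.+ 1) :+ con (ℤ.+ 1)) :* b))
                 refl ε _ _ ⟩
          (1# + 1#) * τ (gold r u) + ε * ((1# + 1#) * τ (gold t u))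
            ≡⟨ cong₂ (λ s t → s + ε * t) (gold-diagonal r u) (gold-diagonal t u) ⟨
          τ (c * A r u * u) + ε * τ (c * A t u * u)
            ≡⟨ τ-L u u ⟨
          τ (L u * u)
            ≡⟨ cong τ (trans (cong (_* u) Lu≡0) (zeroˡ u)) ⟩
          τ 0#
            ≡⟨ τ-0# ⟩
          0# ∎)
        L-+ : ∀ u v → L (u + v) ≡ L u + L v
        L-+ u v = trans (cong₂ (λ a b → c * (a + ε * b)) (A-+ r u v) (A-+ t u v))
          (solve 6 (λ c e a b a′ b′ → c :* (a :+ a′ :+ e :* (b :+ b′)) := c :* (a :+ e :* b) :+ c :* (a′ :+ e :* b′))
               refl c ε _ _ _ _)
        L-scale : ∀ {s} → Fixed s → ∀ u → L (s * u) ≡ s * L u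
        L-scale {s} fs u = trans (cong₂ (λ a b → c * (a + ε * b)) (A-scale r fs u) (A-scale t fs u))
          (solve 5 (λ c e s a b → c :* (s :* a :+ e :* (s :* b)) := s :* (c :* (a :+ e :* b))) refl c ε s _ _)

  -- X^r + X^-r + ε (X^t + X^-t) = X^-r (X^(r+t) + ε) (X^(r-t) + ε) since ε² = 1.
  A-factor : ∀ {ε} → Fixed ε → ε * ε ≡ 1# → ∀ t d u →
    φ (t ℕ.+ d) (A (t ℕ.+ d) u + ε * A t u) ≡ Δ ε (t ℕ.+ d ℕ.+ t) (Δ ε d u)
  A-factor {ε} fε ε²≡1 t d u = begin
    φ r (A r u + ε * A t u)
      ≡⟨ trans (φ-+ r _ _) (cong₂ _+_ (φ-+ r _ _) (trans (φ-* r ε (A t u)) (cong₂ _*_ (φ-Fixed fε r) (φ-+ r _ _)))) ⟩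
    φ r (φ r u) + φ r (φ⁻ r u) + ε * (φ r (φ t u) + φ r (φ⁻ t u))
      ≡⟨ cong₂ _+_ (cong₂ _+_ rr (φφ⁻ r u)) (cong (ε *_) (cong₂ _+_ (φ-∘ r t u) rt)) ⟩
    φ (a ℕ.+ d) u + u + ε * (φ a u + φ d u)
      ≡⟨ cong (λ s → φ (a ℕ.+ d) u + s + ε * (φ a u + φ d u)) (trans (cong (_* u) ε²≡1) (*-identityˡ u)) ⟨
    φ (a ℕ.+ d) u + ε * ε * u + ε * (φ a u + φ d u)
      ≡⟨ solve 5 (λ e u x y z → x :+ e :* e :* u :+ e :* (y :+ z) := x :+ e :* y :+ e :* (z :+ e :* u))
           refl ε u _ _ _ ⟩
    φ (a ℕ.+ d) u + ε * φ a u + ε * (φ d u + ε * u)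
      ≡⟨ cong (_+ ε * (φ d u + ε * u)) (trans (φ-+ a _ _) (cong₂ _+_ (φ-∘ a d u) (trans (φ-* a ε u) (cong (_* φ a u) (φ-Fixed fε a))))) ⟨
    Δ ε a (Δ ε d u) ∎
    where
    r a : ℕ
    r = t ℕ.+ d
    a = r ℕ.+ t
    rr : φ r (φ r u) ≡ φ (a ℕ.+ d) u
    rr = trans (φ-∘ r r u) (cong (λ k → φ k u) (sym (ℕₚ.+-assoc r t d)))
    rt : φ r (φ⁻ t u) ≡ φ d u
    rt = begin
      φ (t ℕ.+ d) (φ⁻ t u)    ≡⟨ cong (λ k → φ k (φ⁻ t u)) (ℕₚ.+-comm t d) ⟩
      φ (d ℕ.+ t) (φ⁻ t u)    ≡⟨ φ-∘ d t (φ⁻ t u) ⟨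
      φ d (φ t (φ⁻ t u))      ≡⟨ cong (φ d) (φφ⁻ t u) ⟩
      φ d u                   ∎

  -- σ^r is injective, so composing with it to clear the negative exponents does not change the
  -- kernel.
  A-kernel-≤ : ∀ {ε} → Fixed ε → ε * ε ≡ 1# → ∀ {r t} → t ≤ r → ∀ u → A r u + ε * A t u ≡ 0# ⇔ Kernel ε (r ℕ.+ t) ∣ r - t ∣ u
  A-kernel-≤ {ε} fε ε²≡1 {r} {t} t≤r u = mk⇔
    (λ eq → trans (sym factor) (trans (cong (φ r) eq) (φ-0# r)))
    (λ ker → φ-injective r (trans factor (trans ker (sym (φ-0# r)))))
    where
    factor : φ r (A r u + ε * A t u) ≡ Δ ε (r ℕ.+ t) (Δ ε ∣ r - t ∣ u)
    factor = trans
      (subst (λ r′ → φ r′ (A r′ u + ε * A t u) ≡ Δ ε (r′ ℕ.+ t) (Δ ε (r ℕ.∸ t) u)) (ℕₚ.m+[n∸m]≡n t≤r) (A-factor fε ε²≡1 t (r ℕ.∸ t) u))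
      (cong (λ d → Δ ε (r ℕ.+ t) (Δ ε d u)) (sym (trans (ℕₚ.∣-∣-comm r t) (ℕₚ.m≤n⇒∣m-n∣≡n∸m t≤r))))

  -- As `ε * ε ≡ 1#`, exchanging `r` and `t` amounts to multiplication by `ε`; this reduces
  -- everything to `t ≤ r`.
  A-swap : ∀ {ε} → ε * ε ≡ 1# → ∀ r t u → A r u + ε * A t u ≡ 0# → A t u + ε * A r u ≡ 0#
  A-swap {ε} ε²≡1 r t u eq = begin
    A t u + ε * A r u             ≡⟨ cong (_+ ε * A r u) (trans (cong (_* A t u) ε²≡1) (*-identityˡ _)) ⟨
    ε * ε * A t u + ε * A r u
      ≡⟨ solve 3 (λ e x y → e :* e :* y :+ e :* x := e :* (x :+ e :* y)) refl ε (A r u) (A t u) ⟩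
    ε * (A r u + ε * A t u)       ≡⟨ cong (ε *_) eq ⟩
    ε * 0#                        ≡⟨ zeroʳ ε ⟩
    0#                            ∎

  A-kernel : ∀ {ε} → Fixed ε → ε * ε ≡ 1# → ∀ r t u → A r u + ε * A t u ≡ 0# ⇔ Kernel ε (r ℕ.+ t) ∣ r - t ∣ u
  A-kernel {ε} fε ε²≡1 r t u = [ (λ t≤r → A-kernel-≤ fε ε²≡1 t≤r u) , swapped ]′ (ℕₚ.≤-total t r)
    where
    swapped : r ≤ t → A r u + ε * A t u ≡ 0# ⇔ Kernel ε (r ℕ.+ t) ∣ r - t ∣ u
    swapped r≤t = mk⇔
      (λ eq → trans (sym same) (Equivalence.to (A-kernel-≤ fε ε²≡1 r≤t u) (A-swap ε²≡1 r t u eq)))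
      (λ ker → A-swap ε²≡1 t r u (Equivalence.from (A-kernel-≤ fε ε²≡1 r≤t u) (trans same ker)))
      where
      same : Δ ε (t ℕ.+ r) (Δ ε ∣ t - r ∣ u) ≡ Δ ε (r ℕ.+ t) (Δ ε ∣ r - t ∣ u)
      same = cong₂ (λ a b → Δ ε a (Δ ε b u)) (ℕₚ.+-comm t r) (ℕₚ.∣-∣-comm t r)

  nearBent⇔count : Fixed c → c ≢ 0# → ∀ {ε} → Fixed ε → ε * ε ≡ 1# → ∀ r t (Q : Carrier → Carrier) →
    (∀ x → Q x ≡ gold r x + ε * gold t x) → NearBent F (λ x → Tr (Q x)) ⇔ count ε (r ℕ.+ t) ∣ r - t ∣ ≡ ℤ.+ p
  nearBent⇔count fc c≢0 {ε} fε ε²≡1 r t Q Q≡ =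
    subst (λ k → NearBent F (λ x → Tr (Q x)) ⇔ k ≡ ℤ.+ p) κ≡count nearBent⇔
    where
    open QuadraticTheory (quadratic fc fε r t Q≡)
    κ≡count : κ ≡ count ε (r ℕ.+ t) ∣ r - t ∣
    κ≡count = ∑-cong (λ u → 𝟙-cong (L fc fε r t u ≟ 0#) (kernel? ε (r ℕ.+ t) ∣ r - t ∣ u)
      (λ Lu≡0 → Equivalence.to (A-kernel fε ε²≡1 r t u) (*-zero-factor c c≢0 Lu≡0))
      (λ ker → trans (cong (c *_) (Equivalence.from (A-kernel fε ε²≡1 r t u) ker)) (zeroʳ c)))

open import Data.Nat using (_+_; _*_)

theorem4 : (p n r t : ℕ) → Prime p → p % 2 ≡ 1 → 1 ≤ n → .{{_ : NonZero p}}
    → (F : FiniteField p n) → (c : Fin p) → ¬ (c ≡ FiniteField.zeroFin F)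
    → (NearBent F (λ x → FiniteField.Tr F (FiniteField._-_ F
    (FiniteField._*_ F (FiniteField.embedFp F c) (FiniteField.pow F x (p ^ r + 1)))
    (FiniteField._*_ F (FiniteField.embedFp F c) (FiniteField.pow F x (p ^ t + 1)))))
    ⇔ (gcd n (r + t) ≡ 1 × gcd n ∣ r - t ∣ ≡ 1 × gcd n p ≡ 1))
    × (NearBent F (λ x → FiniteField.Tr F (FiniteField._+_ F
    (FiniteField._*_ F (FiniteField.embedFp F c) (FiniteField.pow F x (p ^ r + 1)))
    (FiniteField._*_ F (FiniteField.embedFp F c) (FiniteField.pow F x (p ^ t + 1)))))
    ⇔ (gcd n (2 * (r + t)) ≡ 2 × gcd n (2 * ∣ r - t ∣) ≡ 2 × ∣ r - t ∣ % 2 ≡ 1 × gcd n p ≡ 1))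
theorem4 p n r t pr p-odd 1≤n F c c≢0 =
  ⇔-trans (nearBent⇔count fc ec≢0 Fixed-neg1 (solve 0 ((:- con (ℤ.+ 1)) :* (:- con (ℤ.+ 1)) := con (ℤ.+ 1)) refl) r t
            (λ x → gold r x - gold t x)
            (λ x → solve 2 (λ a b → a :- b := a :+ (:- con (ℤ.+ 1)) :* b) refl (gold r x) (gold t x)))
          (count⁻⇔ (r + t) ∣ r - t ∣)
  ,
  ⇔-trans (nearBent⇔count fc ec≢0 Fixed-1 (*-identityˡ 1#) r t
            (λ x → FiniteField._+_ F (gold r x) (gold t x))
            (λ x → solve 2 (λ a b → a :+ b := a :+ con (ℤ.+ 1) :* b) refl (gold r x) (gold t x)))
          (let l , eq = r+t≡∣r-t∣+even r t in count⁺⇔ (r + t) ∣ r - t ∣ l eq)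
  where
  open GoldTheory pr p-odd 1≤n F (FiniteField.embedFp F c) hiding (_+_; _*_)
  fc : Fixed (FiniteField.embedFp F c)
  fc = embedFp-Fixed c
  ec≢0 : embedFp c ≢ 0#
  ec≢0 eq = c≢0 (embedFp-injective (trans eq (sym (ι-mod 0))))
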